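{- Fix $\alpha,\beta>0$. For $n\ge2$ let $S$ be a random $\alpha/\beta$-staircase tableau of size $n$ with law $\mathbb{P}_{n,\alpha,\beta}$, and let $X_n$ be the number of non-empty boxes among the boxes $(n-j,j)$, $1\le j\le n-1$ (the second main diagonal). Then, as $n\to\infty$, $X_n$ converges in distribution to a Poisson random variable with parameter $1$.
   Context: A staircase tableau of size $n$ has boxes $(i,j)$ with $i,j\ge1$ and $i+j\le n+1$, rows numbered from the top and columns from the left. An $\alpha/\beta$-staircase tableau of size $n$ is a filling in which each box is empty or contains $\alpha$ or $\beta$, such that: all boxes in the same column and above an $\alpha$ are empty; all boxes in the same row and to the left of a $\beta$ are empty; every main-diagonal box (with $i+j=n+1$) contains a symbol. $\overline{\mathcal{S}}_n$ is the set of these. The weight is $wt(S)=\alpha^{N_\alpha}\beta^{N_\beta}$ ($N_\alpha,N_\beta$ the numbers of $\alpha$'s, $\beta$'s), and $\mathbb{P}_{n,\alpha,\beta}(S)=wt(S)/\sum_{T\in\overline{\mathcal{S}}_n}wt(T)$. -}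

module Defs where

open import Algebra.Apartness.Bundles using (HeytingField)
open import Algebra.Bundles using (CommutativeRing; Semiring)
open import Data.Empty using (⊥-elim)
open import Data.Fin.Base using (Fin; zero; suc; toℕ)
import Data.Fin.Properties as Fin
open import Data.List.Base using (List; []; _∷_; allFin; cartesianProductWith;
  concatMap; filter; foldr; length; map; upTo)
open import Data.List.Membership.Propositional using (_∈_)
open import Data.List.Membership.Propositional.Properties
  using (∈-cartesianProductWith⁺; ∈-filter⁺; ∈-filter⁻)
open import Data.List.Relation.Unary.All as All using ()
open import Data.List.Relation.Unary.AllPairs using ([]; _∷_)
open import Data.List.Relation.Unary.Any using (here; there)
open import Data.List.Relation.Unary.Unique.Propositional using (Unique)
import Data.List.Relation.Unary.Unique.Propositional.Properties as Unique
open import Data.Nat.Base as ℕ using (ℕ; zero; suc; _∸_; _!)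
import Data.Nat.Properties as ℕ
open import Data.Product.Base using (Σ-syntax; ∃-syntax; _×_; _,_; proj₁; proj₂)
open import Data.Sum.Base using (_⊎_)
open import Data.Vec.Base using (Vec; []; _∷_; lookup; replicate; _∷ʳ_)
open import Function.Base using (_∘_)
open import Function.Bundles using (_⇔_; mk⇔)
open import Level using (_⊔_)
open import Relation.Binary.Core using (Rel)
open import Relation.Binary.PropositionalEquality
  using (_≡_; _≢_; refl; sym; trans; cong)
open import Relation.Binary.Structures using (IsStrictPartialOrder)
open import Relation.Nullary.Decidable using (Dec; yes; no; _×-dec_; _→-dec_; map′; ¬?)
open import Relation.Nullary.Negation using (¬_)
open import Relation.Unary using (Pred; Decidable)

data Entry : Set where
  empty symα symβ : Entry

-- The top row of a staircase of size n + 1 has n + 1 boxes; the remaining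
-- rows form a staircase of size n with the same column numbering.
data Filling : ℕ → Set where
  []  : Filling 0
  _∷_ : ∀ {n} → Vec Entry (suc n) → Filling n → Filling (suc n)

Box : ℕ → Set
Box n = Σ[ i ∈ Fin n ] Fin (n ∸ toℕ i)

-- 1-based coordinates, as in i + j ≤ n + 1.
row col : ∀ {n} → Box n → ℕ
row (i , _) = suc (toℕ i)
col (_ , j) = suc (toℕ j)

boxes : ∀ n → List (Box n)
boxes n = concatMap (λ i → map (i ,_) (allFin (n ∸ toℕ i))) (allFin n)

infix 9 _at_

_at_ : ∀ {n} → Filling n → Box n → Entry
(r ∷ t) at (zero  , j) = lookup r j
(r ∷ t) at (suc i , j) = t at (i , j)

record IsTableau {n} (t : Filling n) : Set where
  constructor isTableau
  field
    above-α  : ∀ b b′ → col b ≡ col b′ → row b ℕ.< row b′ →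
               t at b′ ≡ symα → t at b ≡ empty
    left-β   : ∀ b b′ → row b ≡ row b′ → col b ℕ.< col b′ →
               t at b′ ≡ symβ → t at b ≡ empty
    diagonal : ∀ b → row b ℕ.+ col b ≡ suc n → t at b ≢ empty

infix 4 _≟_

_≟_ : (x y : Entry) → Dec (x ≡ y)
empty ≟ empty = yes refl
empty ≟ symα  = no λ ()
empty ≟ symβ  = no λ ()
symα  ≟ empty = no λ ()
symα  ≟ symα  = yes refl
symα  ≟ symβ  = no λ ()
symβ  ≟ empty = no λ ()
symβ  ≟ symα  = no λ ()
symβ  ≟ symβ  = yes refl

allBoxes? : ∀ {n ℓ} {P : Pred (Box n) ℓ} → Decidable P → Dec (∀ b → P b)
allBoxes? P? = map′ (λ h b → h (proj₁ b) (proj₂ b)) (λ h i j → h (i , j))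
  (Fin.all? λ i → Fin.all? λ j → P? (i , j))

isTableau? : ∀ {n} → Decidable (IsTableau {n})
isTableau? {n} t = map′ (λ (p , q , r) → isTableau p q r)
  (λ (isTableau p q r) → p , q , r)
  ( allBoxes? (λ b → allBoxes? λ b′ → (col b ℕ.≟ col b′) →-dec
      ((row b ℕ.<? row b′) →-dec ((t at b′ ≟ symα) →-dec (t at b ≟ empty))))
  ×-dec allBoxes? (λ b → allBoxes? λ b′ → (row b ℕ.≟ row b′) →-dec
      ((col b ℕ.<? col b′) →-dec ((t at b′ ≟ symβ) →-dec (t at b ≟ empty))))
  ×-dec allBoxes? (λ b → (row b ℕ.+ col b ℕ.≟ suc n) →-dec ¬? (t at b ≟ empty)))

entries : List Entry
entries = empty ∷ symα ∷ symβ ∷ []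

rows : ∀ m → List (Vec Entry m)
rows zero    = [] ∷ []
rows (suc m) = cartesianProductWith _∷_ entries (rows m)

fillings : ∀ n → List (Filling n)
fillings zero    = [] ∷ []
fillings (suc n) = cartesianProductWith _∷_ (rows (suc n)) (fillings n)

tableaux : ∀ n → List (Filling n)
tableaux n = filter isTableau? (fillings n)

-- The list `tableaux n` contains every tableau of size n exactly once.

∈-entries : ∀ x → x ∈ entries
∈-entries empty = here refl
∈-entries symα  = there (here refl)
∈-entries symβ  = there (there (here refl))

∈-rows : ∀ {m} (r : Vec Entry m) → r ∈ rows m
∈-rows []      = here refl
∈-rows (x ∷ r) = ∈-cartesianProductWith⁺ _∷_ (∈-entries x) (∈-rows r)

∈-fillings : ∀ {n} (t : Filling n) → t ∈ fillings n
∈-fillings []      = here refl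
∈-fillings (r ∷ t) = ∈-cartesianProductWith⁺ _∷_ (∈-rows r) (∈-fillings t)

∈-tableaux : ∀ {n} (t : Filling n) → t ∈ tableaux n ⇔ IsTableau t
∈-tableaux {n} t = mk⇔ (proj₂ ∘ ∈-filter⁻ isTableau? {xs = fillings n})
                       (∈-filter⁺ isTableau? (∈-fillings t))

entries-unique : Unique entries
entries-unique = ((λ ()) All.∷ (λ ()) All.∷ All.[]) ∷ ((λ ()) All.∷ All.[]) ∷ All.[] ∷ []

rows-unique : ∀ m → Unique (rows m)
rows-unique zero    = All.[] ∷ []
rows-unique (suc m) = Unique.cartesianProductWith⁺ _∷_ (λ { refl → refl , refl })
  entries-unique (rows-unique m)

fillings-unique : ∀ n → Unique (fillings n)
fillings-unique zero    = All.[] ∷ []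
fillings-unique (suc n) = Unique.cartesianProductWith⁺ _∷_ (λ { refl → refl , refl })
  (rows-unique (suc n)) (fillings-unique n)

tableaux-unique : ∀ n → Unique (tableaux n)
tableaux-unique n = Unique.filter⁺ isTableau? (fillings-unique n)

-- Every size admits a tableau: put α in all diagonal boxes and nowhere else.

α-diagonal : ∀ n → Filling n
α-diagonal zero    = []
α-diagonal (suc n) = (replicate n empty ∷ʳ symα) ∷ α-diagonal n

last-α : ∀ n (j : Fin (suc n)) → suc (toℕ j) ≡ suc n →
         lookup (replicate n empty ∷ʳ symα) j ≡ symα
last-α zero    zero    _ = refl
last-α (suc n) (suc j) e = last-α n j (ℕ.suc-injective e)

not-last : ∀ n (j : Fin (suc n)) → suc (toℕ j) ≢ suc n →
           lookup (replicate n empty ∷ʳ symα) j ≡ empty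
not-last zero    zero    ne = ⊥-elim (ne refl)
not-last (suc n) zero    _  = refl
not-last (suc n) (suc j) ne = not-last n j (ne ∘ cong suc)

on-diagonal : ∀ {n} (b : Box n) → row b ℕ.+ col b ≡ suc n → α-diagonal n at b ≡ symα
on-diagonal {suc n} (zero  , j) e = last-α n j (ℕ.suc-injective e)
on-diagonal {suc n} (suc i , j) e = on-diagonal (i , j) (ℕ.suc-injective e)

off-diagonal : ∀ {n} (b : Box n) → row b ℕ.+ col b ≢ suc n → α-diagonal n at b ≡ empty
off-diagonal {suc n} (zero  , j) ne = not-last n j (ne ∘ cong suc)
off-diagonal {suc n} (suc i , j) ne = off-diagonal (i , j) (ne ∘ cong suc)

α-diagonal-isTableau : ∀ n → IsTableau (α-diagonal n)
α-diagonal-isTableau n = isTableau above left diag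
  where
  above : ∀ b b′ → col b ≡ col b′ → row b ℕ.< row b′ →
          α-diagonal n at b′ ≡ symα → α-diagonal n at b ≡ empty
  above b b′ c≡ r< α≡ with row b′ ℕ.+ col b′ ℕ.≟ suc n
  ... | no ne with () ← trans (sym α≡) (off-diagonal b′ ne)
  ... | yes e = off-diagonal b λ e′ → ℕ.<⇒≢ r<
    (ℕ.+-cancelʳ-≡ (col b) (row b) (row b′)
      (trans e′ (trans (sym e) (cong (row b′ ℕ.+_) (sym c≡)))))

  left : ∀ b b′ → row b ≡ row b′ → col b ℕ.< col b′ →
         α-diagonal n at b′ ≡ symβ → α-diagonal n at b ≡ empty
  left b b′ _ _ β≡ with row b′ ℕ.+ col b′ ℕ.≟ suc n
  ... | no ne with () ← trans (sym β≡) (off-diagonal b′ ne)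
  ... | yes e with () ← trans (sym β≡) (on-diagonal b′ e)

  diag : ∀ b → row b ℕ.+ col b ≡ suc n → α-diagonal n at b ≢ empty
  diag b e ≡empty with () ← trans (sym (on-diagonal b e)) ≡empty

Nα Nβ : ∀ {n} → Filling n → ℕ
Nα {n} t = length (filter (λ b → t at b ≟ symα) (boxes n))
Nβ {n} t = length (filter (λ b → t at b ≟ symβ) (boxes n))

-- Number of non-empty boxes (n - j , j), 1 ≤ j ≤ n - 1.
secondDiagonal : ∀ {n} → Filling n → ℕ
secondDiagonal {n} t =
  length (filter (λ b → (row b ℕ.+ col b ℕ.≟ n) ×-dec ¬? (t at b ≟ empty)) (boxes n))

-- The real numbers, axiomatised as a Cauchy-complete Archimedean ordered
-- field.  Classically this determines ℝ up to unique isomorphism; the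
-- axioms are those of the constructive theory, where apartness replaces
-- inequality and the order need not be decidable.

record OrderedField c ℓ₁ ℓ₂ ℓ₃ : Set (Level.suc (c ⊔ ℓ₁ ⊔ ℓ₂ ⊔ ℓ₃)) where
  infix 4 _<_ _≤_ _⟶_

  field
    heytingField : HeytingField c ℓ₁ ℓ₂

  open HeytingField heytingField public
    renaming (refl to ≈-refl; sym to ≈-sym; trans to ≈-trans)

  field
    _<_                  : Rel Carrier ℓ₃
    isStrictPartialOrder : IsStrictPartialOrder _≈_ _<_
    #⇒<⊎>                : ∀ {x y} → x # y → x < y ⊎ y < x
    <⇒#                  : ∀ {x y} → x < y → x # y
    0<1                  : 0# < 1#
    +-monoʳ-<            : ∀ z {x y} → x < y → z + x < z + y
    *-positive           : ∀ {x y} → 0# < x → 0# < y → 0# < x * y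

  commutativeRing : CommutativeRing c ℓ₁
  commutativeRing = record { isCommutativeRing = isCommutativeRing }

  open import Algebra.Definitions.RawSemiring
    (Semiring.rawSemiring (CommutativeRing.semiring commutativeRing)) public
    using (_^_) renaming (_×_ to _·_)

  fromℕ : ℕ → Carrier
  fromℕ n = n · 1#

  _≤_ : Rel Carrier ℓ₃
  x ≤ y = ¬ (y < x)

  -- ∣ x - y ∣ < ε
  Within : Carrier → Rel Carrier ℓ₃
  Within ε x y = (x - y < ε) × (y - x < ε)

  _⟶_ : (ℕ → Carrier) → Carrier → Set (c ⊔ ℓ₃)
  s ⟶ l = ∀ ε → 0# < ε → ∃[ N ] ∀ n → N ℕ.≤ n → Within ε (s n) l

  Cauchy : (ℕ → Carrier) → Set (c ⊔ ℓ₃)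
  Cauchy s = ∀ ε → 0# < ε →
             ∃[ N ] ∀ m n → N ℕ.≤ m → N ℕ.≤ n → Within ε (s m) (s n)

record RealNumbers c ℓ₁ ℓ₂ ℓ₃ : Set (Level.suc (c ⊔ ℓ₁ ⊔ ℓ₂ ⊔ ℓ₃)) where
  field
    orderedField : OrderedField c ℓ₁ ℓ₂ ℓ₃

  open OrderedField orderedField public

  field
    archimedean : ∀ x → ∃[ n ] x < fromℕ n
    complete    : ∀ s → Cauchy s → ∃[ l ] s ⟶ l

module Probability {c ℓ₁ ℓ₂ ℓ₃} (R : RealNumbers c ℓ₁ ℓ₂ ℓ₃) where

  open RealNumbers R
  open IsStrictPartialOrder isStrictPartialOrder
    using (<-respʳ-≈) renaming (trans to <-trans)

  ∑ : ∀ {a} {A : Set a} → List A → (A → Carrier) → Carrier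
  ∑ xs f = foldr (λ x s → f x + s) 0# xs

  -- The inverse is that of y - 0#, which is ≈ to y.
  divide : (x y : Carrier) → 0# < y → Carrier
  divide x y 0<y = x * proj₁ (#⇒invertible (#-sym (<⇒# 0<y)))

  +-positive : ∀ {x y} → 0# < x → 0# < y → 0# < x + y
  +-positive {x} 0<x 0<y = <-trans 0<x (<-respˡ (+-monoʳ-< x 0<y))
    where
    <-respˡ : ∀ {z} → x + 0# < z → x < z
    <-respˡ = IsStrictPartialOrder.<-respˡ-≈ isStrictPartialOrder (+-identityʳ x)

  ^-positive : ∀ {x} → 0# < x → ∀ n → 0# < x ^ n
  ^-positive 0<x zero    = 0<1
  ^-positive 0<x (suc n) = *-positive 0<x (^-positive 0<x n)

  fromℕ-positive : ∀ n → .{{ℕ.NonZero n}} → 0# < fromℕ n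
  fromℕ-positive (suc zero)    = <-respʳ-≈ (≈-sym (+-identityʳ 1#)) 0<1
  fromℕ-positive (suc (suc n)) = +-positive 0<1 (fromℕ-positive (suc n))

  ∑-positive : ∀ {a} {A : Set a} {f : A → Carrier} → (∀ x → 0# < f x) →
               ∀ {x xs} → x ∈ xs → 0# < ∑ xs f
  ∑-positive {f = f} 0<f {xs = x ∷ []}     _ =
    <-respʳ-≈ (≈-sym (+-identityʳ (f x))) (0<f x)
  ∑-positive         0<f {xs = x ∷ y ∷ ys} _ =
    +-positive (0<f x) (∑-positive 0<f {xs = y ∷ ys} (here refl))

  module _ (α β : Carrier) (0<α : 0# < α) (0<β : 0# < β) where

    wt : ∀ {n} → Filling n → Carrier
    wt t = α ^ Nα t * β ^ Nβ t

    totalWeight : ℕ → Carrier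
    totalWeight n = ∑ (tableaux n) wt

    totalWeight-positive : ∀ n → 0# < totalWeight n
    totalWeight-positive n = ∑-positive
      (λ t → *-positive (^-positive 0<α (Nα t)) (^-positive 0<β (Nβ t)))
      (∈-filter⁺ isTableau? (∈-fillings (α-diagonal n)) (α-diagonal-isTableau n))

    ℙ : ∀ {n} → Filling n → Carrier
    ℙ {n} t = divide (wt t) (totalWeight n) (totalWeight-positive n)

    -- lawX n k is the probability that X_n = k.
    lawX : ℕ → ℕ → Carrier
    lawX n k = ∑ (filter (λ t → secondDiagonal t ℕ.≟ k) (tableaux n)) ℙ

  -- Laws of ℕ-valued random variables, given by their mass functions

  -- A real point at which the step function cdf can be evaluated.
  -- Classically every real is one; constructively every real that is apart
  -- from all natural numbers is one.
  record Point : Set (c ⊔ ℓ₃) where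
    field
      value   : Carrier
      decide≤ : ∀ k → Dec (fromℕ k ≤ value)

  open Point

  -- The sum of p k over all k with fromℕ k ≤ value x; the Archimedean bound
  -- only serves to make the range of summation finite.
  cdf : (ℕ → Carrier) → Point → Carrier
  cdf p x = ∑ (filter (decide≤ x) (upTo (proj₁ (archimedean (value x))))) p

  ContinuousAt : (Point → Carrier) → Point → Set (c ⊔ ℓ₃)
  ContinuousAt F x = ∀ ε → 0# < ε → ∃[ δ ] (0# < δ) ×
    (∀ y → Within δ (value y) (value x) → Within ε (F y) (F x))

  ConvergesInDistribution : (ℕ → ℕ → Carrier) → (ℕ → Carrier) → Set (c ⊔ ℓ₃)
  ConvergesInDistribution p q =
    ∀ x → ContinuousAt (cdf q) x → (λ n → cdf (p n) x) ⟶ cdf q x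

  expTerm : Carrier → ℕ → Carrier
  expTerm x k = divide (x ^ k) (fromℕ (k !)) (fromℕ-positive (k !) {{ℕ._!≢0 k}})

  -- e is the value of the exponential series at x.
  IsExp : Carrier → Carrier → Set (c ⊔ ℓ₃)
  IsExp x e = (λ n → ∑ (upTo n) (expTerm x)) ⟶ e

  IsPoisson : Carrier → (ℕ → Carrier) → Set (c ⊔ ℓ₁ ⊔ ℓ₃)
  IsPoisson rate q =
    ∃[ e ] IsExp (- rate) e × (∀ k → q k ≈ e * expTerm rate k)

{-# OPTIONS --safe #-}
-- Let γ = α β, and let S n z φ be the sum of wt t · z^(number of columns of t
-- without α) · φ (Xₙ t) over all tableaux t of size n.  Summing over the top row
-- gives
--
--   S (n + 2) z φ = (α + β z) (S (n + 1) (z + α) φ + γ S n (z + α) (Δ φ)),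
--
-- because a non-empty box next to the top diagonal box forces the row below to
-- consist of a single β.  The solution is
--
--   S n z φ = Σ_r C(n - r, r) γ^r F (n - r) z (Δʳ φ)(0),
--   F n z   = Π_{i < n} (α + β (z + i α)).
--
-- At z = 1 this says that E C(Xₙ, r) = C(n - r, r) γ^r F (n - r) 1 / F n 1, which
-- tends to 1 / r!.  Since (r + 1) E C(Xₙ, r + 1) ≤ E C(Xₙ, r), the alternating
-- sum that expresses P(Xₙ = k) in these moments is truncated with an error that
-- is small uniformly in n, and it converges to e⁻¹ / k!.
module Submission where

open import Defs
open import Data.Product.Base using (∃-syntax; _×_)

open import Algebra.Bundles using (CommutativeRing)
import Algebra.Properties.AbelianGroup
import Algebra.Properties.Ring
import Algebra.Properties.Semiring.Exp
import Algebra.Properties.Semiring.Mult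
import Algebra.Properties.Semiring.Mult.TCOptimised
import Algebra.Solver.Ring
open import Algebra.Solver.Ring.AlmostCommutativeRing
  using (fromCommutativeRing; _-Raw-AlmostCommutative⟶_)
open import Data.Bool.Base using (Bool; true; false; _∧_; _∨_; not; if_then_else_)
import Data.Bool.Properties as Bool
open import Data.Fin.Base using (Fin; zero; suc; toℕ; fromℕ<)
import Data.Fin.Properties as Fin
open import Data.Integer.Base as ℤ using (ℤ; -[1+_]; _⊖_)
import Data.Integer.Properties as ℤ
open import Data.List.Base using (List; []; _∷_; _++_; allFin; cartesianProductWith;
  concatMap; filter; length; map; tabulate; upTo)
import Data.List.Properties as List
open import Data.Maybe.Base using (Maybe; just; nothing)
open import Data.Nat.Base as ℕ using (ℕ; zero; suc; _∸_; _!; z≤n; s≤s; z<s; s<s)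
open import Data.Nat.Combinatorics using (_C_; nCn≡1; nC1≡n; nCk≡nC[n∸k]; k>n⇒nCk≡0;
  nCk+nC[k+1]≡[n+1]C[k+1])
import Data.Nat.Properties as ℕ
import Data.Nat.Tactic.RingSolver as ℕ
open import Data.Product.Base using (_,_; proj₁; proj₂)
open import Data.Sum.Base using (_⊎_; inj₁; inj₂; [_,_]′)
open import Data.Vec.Base using (Vec; []; _∷_; lookup)
open import Function.Base using (_∘_; id)
open import Function.Bundles using (_⇔_; mk⇔; Equivalence)
open import Level using (_⊔_)
open import Relation.Binary.PropositionalEquality as ≡ using (_≡_; _≢_)
import Relation.Binary.Reasoning.Setoid
open import Relation.Binary.Structures using (IsStrictPartialOrder)
open import Relation.Nullary.Decidable using (Dec; yes; no; does; _×-dec_; ¬?)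
open import Relation.Nullary.Negation using (contradiction)
open import Relation.Unary using (Pred; Decidable)

-- The variable z is what closes the recursion over rows. A new top row sees the tableau below only
-- through its α-free columns: each is left empty and stays α-free (z) or receives an α (α), except
-- that the leftmost symbol of the row may be a β. Prepending a row therefore turns z into z + α, so
-- sums taken at z = 1 alone would satisfy no recursion among themselves. The second diagonal
-- singles out the last column; evaluating its contribution takes one more row and produces the term
-- in Δ φ.
--
-- Binomial moments are single products, so their limits come from quotients of consecutive values.
-- The probabilities are alternating sums of them, of length growing with n, and recovering them
-- means exchanging two limits. As the order of the reals is not assumed decidable, estimates on
-- moments are stated for quantities known to be zero or known to be positive, and the truncation
-- index is a natural number computed from ε alone.

-- The solver needs decidable coefficients in order to cancel, which the ring
-- itself does not provide; hence the integers.
module IntegerCoefficients {c ℓ} (R : CommutativeRing c ℓ) where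

  open CommutativeRing R
  open Algebra.Properties.Ring ring
  open Algebra.Properties.AbelianGroup +-abelianGroup using (⁻¹-∙-comm)
  open Algebra.Properties.Semiring.Mult.TCOptimised semiring
    using (×-homo-+; ×1-homo-*; 1+×) renaming (_×_ to _·_)
  open Relation.Binary.Reasoning.Setoid setoid
  open import Data.Integer.Base using (+_)

  fromℤ : ℤ → Carrier
  fromℤ (+ n)    = n · 1#
  fromℤ -[1+ n ] = - (suc n · 1#)

  private
    neg : ∀ i → fromℤ (ℤ.- i) ≈ - fromℤ i
    neg (+ zero)  = sym -0#≈0#
    neg (+ suc n) = refl
    neg -[1+ n ]  = sym (-‿involutive _)

    -- Integers of mixed sign are added through `⊖`, whose recursion removes one unit from each
    -- argument; the inserted `1# - 1#` matches that step.
    sub : ∀ m n → fromℤ (m ⊖ n) ≈ m · 1# - n · 1#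
    sub m       zero    = sym (trans (+-congˡ -0#≈0#) (+-identityʳ _))
    sub zero    (suc n) = sym (+-identityˡ _)
    sub (suc m) (suc n) = begin
      fromℤ (suc m ⊖ suc n)                     ≡⟨ ≡.cong fromℤ (ℤ.[1+m]⊖[1+n]≡m⊖n m n) ⟩
      fromℤ (m ⊖ n)                             ≈⟨ sub m n ⟩
      m · 1# - n · 1#                           ≈⟨ +-congʳ (+-identityʳ _) ⟨
      m · 1# + 0# - n · 1#                      ≈⟨ +-congʳ (+-congˡ (-‿inverseʳ 1#)) ⟨
      m · 1# + (1# - 1#) - n · 1#               ≈⟨ +-congʳ (+-assoc _ _ _) ⟨
      m · 1# + 1# - 1# - n · 1#                 ≈⟨ +-assoc _ _ _ ⟩
      m · 1# + 1# + (- 1# - n · 1#)             ≈⟨ +-cong (+-comm _ _) (⁻¹-∙-comm _ _) ⟩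
      1# + m · 1# - (1# + n · 1#)               ≈⟨ +-cong (1+× m 1#) (-‿cong (1+× n 1#)) ⟨
      suc m · 1# - suc n · 1#                   ∎

    add : ∀ i j → fromℤ (i ℤ.+ j) ≈ fromℤ i + fromℤ j
    add (+ m)    (+ n)    = ×-homo-+ 1# m n
    add (+ m)    -[1+ n ] = sub m (suc n)
    add -[1+ m ] (+ n)    = trans (sub n (suc m)) (+-comm _ _)
    add -[1+ m ] -[1+ n ] = begin
      - (suc (suc (m ℕ.+ n)) · 1#)        ≡⟨ ≡.cong (λ k → - (suc k · 1#)) (ℕ.+-suc m n) ⟨
      - ((suc m ℕ.+ suc n) · 1#)          ≈⟨ -‿cong (×-homo-+ 1# (suc m) (suc n)) ⟩
      - (suc m · 1# + suc n · 1#)         ≈⟨ ⁻¹-∙-comm _ _ ⟨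
      - (suc m · 1#) - suc n · 1#         ∎

    mul⁺ : ∀ m j → fromℤ (+ m ℤ.* j) ≈ fromℤ (+ m) * fromℤ j
    mul⁺ m (+ n)    = begin
      fromℤ (+ m ℤ.* + n)    ≡⟨ ≡.cong fromℤ (ℤ.pos-* m n) ⟨
      (m ℕ.* n) · 1#         ≈⟨ ×1-homo-* m n ⟩
      m · 1# * n · 1#        ∎
    mul⁺ m -[1+ n ] = begin
      fromℤ (+ m ℤ.* -[1+ n ])         ≡⟨ ≡.cong fromℤ (ℤ.neg-distribʳ-* (+ m) (+ suc n)) ⟨
      fromℤ (ℤ.- (+ m ℤ.* + suc n))    ≈⟨ neg (+ m ℤ.* + suc n) ⟩
      - fromℤ (+ m ℤ.* + suc n)        ≈⟨ -‿cong (mul⁺ m (+ suc n)) ⟩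
      - (m · 1# * suc n · 1#)          ≈⟨ -‿distribʳ-* _ _ ⟩
      m · 1# * - (suc n · 1#)          ∎

    mul : ∀ i j → fromℤ (i ℤ.* j) ≈ fromℤ i * fromℤ j
    mul (+ m)    j = mul⁺ m j
    mul -[1+ m ] j = begin
      fromℤ (-[1+ m ] ℤ.* j)           ≡⟨ ≡.cong fromℤ (ℤ.neg-distribˡ-* (+ suc m) j) ⟨
      fromℤ (ℤ.- (+ suc m ℤ.* j))      ≈⟨ neg (+ suc m ℤ.* j) ⟩
      - fromℤ (+ suc m ℤ.* j)          ≈⟨ -‿cong (mul⁺ (suc m) j) ⟩
      - (suc m · 1# * fromℤ j)         ≈⟨ -‿distribˡ-* _ _ ⟩
      - (suc m · 1#) * fromℤ j         ∎

    homomorphism : ℤ.+-*-rawRing -Raw-AlmostCommutative⟶ fromCommutativeRing R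
    homomorphism = record
      { ⟦_⟧    = fromℤ
      ; +-homo = add
      ; *-homo = mul
      ; -‿homo = neg
      ; 0-homo = refl
      ; 1-homo = refl
      }

    _coeff≟_ : ∀ i j → Maybe (fromℤ i ≈ fromℤ j)
    i coeff≟ j with i ℤ.≟ j
    ... | yes eq = just (reflexive (≡.cong fromℤ eq))
    ... | no  _  = nothing

  open Algebra.Solver.Ring ℤ.+-*-rawRing (fromCommutativeRing R) homomorphism _coeff≟_ public
    using (Polynomial; solve; con; _:=_; _:+_; _:*_; _:-_; :-_)

  :0 :1 : ∀ {n} → Polynomial n
  :0 = con (+ 0)
  :1 = con (+ 1)

open ≡ using (refl; sym; trans; cong; cong₂)

-- Tableaux row by row

below : ∀ {n} → Box n → Box (suc n)
below (i , j) = suc i , j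

boxes-suc : ∀ n → boxes (suc n) ≡ map (zero ,_) (allFin (suc n)) ++ map below (boxes n)
boxes-suc n = cong (map (zero ,_) (allFin (suc n)) ++_) (begin
  concatMap row′ (tabulate suc)                      ≡⟨ cong (concatMap row′)
      (List.map-tabulate id suc) ⟨
  concatMap row′ (map suc (allFin n))                ≡⟨ List.concatMap-map row′ suc (allFin n) ⟩
  concatMap (row′ ∘ suc) (allFin n)                  ≡⟨ List.concatMap-cong
      (λ i → List.map-∘ (allFin (n ∸ toℕ i))) (allFin n) ⟩
  concatMap (map below ∘ boxesOfRow) (allFin n)      ≡⟨ List.map-concatMap below boxesOfRow (allFin n) ⟨
  map below (boxes n)                                ∎)
  where
  open ≡.≡-Reasoning
  row′ : Fin (suc n) → List (Box (suc n))
  row′ i = map (i ,_) (allFin (suc n ∸ toℕ i))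
  boxesOfRow : Fin n → List (Box n)
  boxesOfRow i = map (i ,_) (allFin (n ∸ toℕ i))

-- Counting symbols row by row

count : ∀ {a p} {A : Set a} {P : Pred A p} → Decidable P → List A → ℕ
count P? xs = length (filter P? xs)

count-map : ∀ {a b p} {A : Set a} {B : Set b} {P : Pred B p} (P? : Decidable P) (f : A → B) xs →
            count P? (map f xs) ≡ count (P? ∘ f) xs
count-map P? f []       = refl
count-map P? f (x ∷ xs) with does (P? (f x))
... | true  = cong suc (count-map P? f xs)
... | false = count-map P? f xs

count-++ : ∀ {a p} {A : Set a} {P : Pred A p} (P? : Decidable P) xs ys →
           count P? (xs ++ ys) ≡ count P? xs ℕ.+ count P? ys
count-++ P? xs ys = trans (cong length (List.filter-++ P? xs ys)) (List.length-++ (filter P? xs))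

-- Only the Boolean values are compared. Tests on shifted indices, such as `suc m` against `suc n`
-- and `m` against `n`, compute to the same Boolean although their proofs differ, so they can be
-- exchanged by `refl`.
count-cong : ∀ {a p q} {A : Set a} {P : Pred A p} {Q : Pred A q} (P? : Decidable P) (Q? : Decidable Q) →
             (∀ x → does (P? x) ≡ does (Q? x)) → ∀ xs → count P? xs ≡ count Q? xs
count-cong P? Q? eq []       = refl
count-cong P? Q? eq (x ∷ xs) with does (P? x) | does (Q? x) | eq x
... | true  | .true  | refl = cong suc (count-cong P? Q? eq xs)
... | false | .false | refl = count-cong P? Q? eq xs

count-allFin : ∀ {n p} {P : Pred (Fin (suc n)) p} (P? : Decidable P) →
               count P? (allFin (suc n)) ≡
               (if does (P? zero) then 1 else 0) ℕ.+ count (P? ∘ suc) (allFin n)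
count-allFin {n} P? with does (P? zero) | trans (cong (count P?) (sym (List.map-tabulate id suc)))
    (count-map P? suc (allFin n))
... | true  | eq = cong suc eq
... | false | eq = eq

count-boxes : ∀ {n p} {P : Pred (Box (suc n)) p} (P? : Decidable P) →
              count P? (boxes (suc n)) ≡
              count (P? ∘ (zero ,_)) (allFin (suc n)) ℕ.+ count (P? ∘ below) (boxes n)
count-boxes {n} P? = trans (cong (count P?) (boxes-suc n))
  (trans (count-++ P? (map (zero ,_) (allFin (suc n))) (map below (boxes n)))
    (cong₂ ℕ._+_ (count-map P? (zero ,_) (allFin (suc n))) (count-map P? below (boxes n))))

isEmpty notα : Entry → Bool
isEmpty empty = true
isEmpty _     = false
notα symα = false
notα _    = true

#α #β : ∀ {n} → Vec Entry n → ℕ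
#α []          = 0
#α (symα  ∷ r) = suc (#α r)
#α (_     ∷ r) = #α r
#β []          = 0
#β (symβ  ∷ r) = suc (#β r)
#β (_     ∷ r) = #β r

count-α : ∀ {n} (r : Vec Entry n) → count (λ j → lookup r j ≟ symα) (allFin n) ≡ #α r
count-α []          = refl
count-α (empty ∷ r) = trans (count-allFin (λ j → lookup (empty ∷ r) j ≟ symα)) (count-α r)
count-α (symα  ∷ r) = trans (count-allFin (λ j → lookup (symα ∷ r) j ≟ symα)) (cong suc (count-α r))
count-α (symβ  ∷ r) = trans (count-allFin (λ j → lookup (symβ ∷ r) j ≟ symα)) (count-α r)

count-β : ∀ {n} (r : Vec Entry n) → count (λ j → lookup r j ≟ symβ) (allFin n) ≡ #β r
count-β []          = refl
count-β (empty ∷ r) = trans (count-allFin (λ j → lookup (empty ∷ r) j ≟ symβ)) (count-β r)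
count-β (symα  ∷ r) = trans (count-allFin (λ j → lookup (symα ∷ r) j ≟ symβ)) (count-β r)
count-β (symβ  ∷ r) = trans (count-allFin (λ j → lookup (symβ ∷ r) j ≟ symβ)) (cong suc (count-β r))

Nα-∷ : ∀ {n} (r : Vec Entry (suc n)) (t : Filling n) → Nα (r ∷ t) ≡ #α r ℕ.+ Nα t
Nα-∷ {n} r t = trans (count-boxes (λ b → (r ∷ t) at b ≟ symα)) (cong (ℕ._+ Nα t) (count-α r))

Nβ-∷ : ∀ {n} (r : Vec Entry (suc n)) (t : Filling n) → Nβ (r ∷ t) ≡ #β r ℕ.+ Nβ t
Nβ-∷ {n} r t = trans (count-boxes (λ b → (r ∷ t) at b ≟ symβ)) (cong (ℕ._+ Nβ t) (count-β r))

-- The box to the left of the diagonal box is the one of the top row that lies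
-- on the second diagonal.
beforeLast : ∀ {n} → Vec Entry (suc n) → ℕ
beforeLast (x ∷ [])        = 0
beforeLast (x ∷ y ∷ [])    = if isEmpty x then 0 else 1
beforeLast (x ∷ y ∷ w ∷ r) = beforeLast (y ∷ w ∷ r)

count-beforeLast : ∀ {n} (r : Vec Entry (suc n)) →
  count (λ j → (2 ℕ.+ toℕ j ℕ.≟ suc n) ×-dec ¬? (lookup r j ≟ empty)) (allFin (suc n)) ≡ beforeLast r
count-beforeLast (x ∷ []) = refl
count-beforeLast (empty ∷ y ∷ []) = refl
count-beforeLast (symα  ∷ y ∷ []) = refl
count-beforeLast (symβ  ∷ y ∷ []) = refl
count-beforeLast {suc (suc n)} r@(x ∷ r′@(y ∷ w ∷ _)) = trans
  (count-allFin (λ j → (2 ℕ.+ toℕ j ℕ.≟ suc (suc (suc n))) ×-dec ¬? (lookup r j ≟ empty)))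
  (trans (count-cong _ (λ j → (2 ℕ.+ toℕ j ℕ.≟ suc (suc n)) ×-dec ¬? (lookup r′ j ≟ empty))
      (λ _ → refl) (allFin (suc (suc n))))
         (count-beforeLast r′))

secondDiagonal-∷ : ∀ {n} (r : Vec Entry (suc n)) (t : Filling n) →
                   secondDiagonal (r ∷ t) ≡ beforeLast r ℕ.+ secondDiagonal t
secondDiagonal-∷ {n} r t = trans
  (count-boxes (λ b → (row b ℕ.+ col b ℕ.≟ suc n) ×-dec ¬? ((r ∷ t) at b ≟ empty)))
  (cong₂ ℕ._+_
    (trans (count-cong _ (λ j → (2 ℕ.+ toℕ j ℕ.≟ suc n) ×-dec ¬? (lookup r j ≟ empty)) (λ _ → refl)
        (allFin (suc n)))
           (count-beforeLast r))
    (count-cong _ (λ b → (row b ℕ.+ col b ℕ.≟ n) ×-dec ¬? (t at b ≟ empty)) (λ _ → refl) (boxes n)))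

-- Rows that fit on top of a tableau

βFree : ∀ {n} → Vec Entry n → Bool
βFree []         = true
βFree (symβ ∷ r) = false
βFree (_    ∷ r) = βFree r

-- Whether the row may be put on top of a tableau whose α-free columns are
-- those marked in the first argument.
fits : ∀ {n} → Vec Bool n → Vec Entry (suc n) → Bool
fits []       (x ∷ []) = not (isEmpty x)
fits (b ∷ bs) (x ∷ r)  = fits bs r ∧ (isEmpty x ∨ (b ∧ βFree r))

freeAfter : ∀ {n} → Vec Bool n → Vec Entry (suc n) → Vec Bool (suc n)
freeAfter []       (x ∷ []) = notα x ∷ []
freeAfter (b ∷ bs) (x ∷ r)  = (b ∧ notα x) ∷ freeAfter bs r

αFree : ∀ {n} → Filling n → Vec Bool n
αFree []      = []
αFree (r ∷ t) = freeAfter (αFree t) r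

βFree-sound : ∀ {n} (r : Vec Entry n) → βFree r ≡ true → ∀ j → lookup r j ≢ symβ
βFree-sound (empty ∷ r) h (suc j) = βFree-sound r h j
βFree-sound (symα  ∷ r) h (suc j) = βFree-sound r h j
βFree-sound (empty ∷ r) h zero ()
βFree-sound (symα  ∷ r) h zero ()

βFree-complete : ∀ {n} (r : Vec Entry n) → (∀ j → lookup r j ≢ symβ) → βFree r ≡ true
βFree-complete []          h = refl
βFree-complete (empty ∷ r) h = βFree-complete r (h ∘ suc)
βFree-complete (symα  ∷ r) h = βFree-complete r (h ∘ suc)
βFree-complete (symβ  ∷ r) h = contradiction refl (h zero)

-- The diagonal column of the new row has no counterpart in `bs`. Relating `k` and `j` by `toℕ`
-- includes this column, for which no `k` exists.
freeAfter-true : ∀ {n} (bs : Vec Bool n) (r : Vec Entry (suc n)) j → lookup (freeAfter bs r) j ≡ true →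
                 lookup r j ≢ symα × (∀ k → toℕ k ≡ toℕ j → lookup bs k ≡ true)
freeAfter-true []           (empty ∷ []) zero    _ = (λ ()) , λ ()
freeAfter-true []           (symβ  ∷ []) zero    _ = (λ ()) , λ ()
freeAfter-true (true  ∷ bs) (empty ∷ r)  zero    _ = (λ ()) , λ { zero _ → refl }
freeAfter-true (true  ∷ bs) (symβ  ∷ r)  zero    _ = (λ ()) , λ { zero _ → refl }
freeAfter-true (b     ∷ bs) (x     ∷ r)  (suc j) h with freeAfter-true bs r j h
... | p , q = p , λ { (suc k) e → q k (ℕ.suc-injective e) }

freeAfter-false : ∀ {n} (bs : Vec Bool n) (r : Vec Entry (suc n)) j →
    lookup (freeAfter bs r) j ≡ false →
                  lookup r j ≡ symα ⊎ (∃[ k ] toℕ k ≡ toℕ j × lookup bs k ≡ false)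
freeAfter-false []           (symα ∷ []) zero    _ = inj₁ refl
freeAfter-false (false ∷ bs) (x    ∷ r)  zero    _ = inj₂ (zero , refl , refl)
freeAfter-false (true  ∷ bs) (symα ∷ r)  zero    _ = inj₁ refl
freeAfter-false (b     ∷ bs) (x    ∷ r)  (suc j) h with freeAfter-false bs r j h
... | inj₁ p           = inj₁ p
... | inj₂ (k , e , p) = inj₂ (suc k , cong suc e , p)

αFree-true : ∀ {n} (t : Filling n) j → lookup (αFree t) j ≡ true →
             ∀ b → toℕ (proj₂ b) ≡ toℕ j → t at b ≢ symα
αFree-true (r ∷ t) j h (zero , k) e with refl ← Fin.toℕ-injective e =
  proj₁ (freeAfter-true (αFree t) r j h)
αFree-true {suc n} (r ∷ t) j h (suc i , k) e = αFree-true t k′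
  (proj₂ (freeAfter-true (αFree t) r j h) k′ (trans (Fin.toℕ-fromℕ< _) e)) (i , k)
      (sym (Fin.toℕ-fromℕ< _))
  -- Row `i` has only `n ∸ toℕ i` boxes, so its index `k` has to be read again as a column of the
  -- whole of `t`.
  where k′ = Data.Fin.Base.fromℕ< (ℕ.<-≤-trans (Fin.toℕ<n k) (ℕ.m∸n≤m n (toℕ i)))

αFree-false : ∀ {n} (t : Filling n) j → lookup (αFree t) j ≡ false →
              ∃[ b ] toℕ (proj₂ b) ≡ toℕ j × t at b ≡ symα
αFree-false (r ∷ t) j h with freeAfter-false (αFree t) r j h
... | inj₁ p = (zero , j) , refl , p
... | inj₂ (k , e , p) with αFree-false t k p
...   | b , e′ , q = below b , trans e′ e , q

record Fits {n} (bs : Vec Bool n) (r : Vec Entry (suc n)) : Set where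
  constructor isFit
  field
    blocked : ∀ k j → toℕ k ≡ toℕ j → lookup bs k ≡ false → lookup r j ≡ empty
    left-β  : ∀ j k → toℕ j ℕ.< toℕ k → lookup r k ≡ symβ → lookup r j ≡ empty
    last    : ∀ j → toℕ j ≡ n → lookup r j ≢ empty

fits-sound : ∀ {n} (bs : Vec Bool n) r → fits bs r ≡ true → Fits bs r
fits-sound [] (symα ∷ []) _ = isFit (λ ()) (λ { zero zero () _ }) (λ { zero _ () })
fits-sound [] (symβ ∷ []) _ = isFit (λ ()) (λ { zero zero () _ }) (λ { zero _ () })
fits-sound {suc n} (b ∷ bs) (x ∷ r) h with fits bs r in eq
... | true with isFit blocked left-β last ← fits-sound bs r eq = isFit
  (λ { zero zero _ f → first-blocked b x h f ; (suc k) (suc j) e → blocked k j (ℕ.suc-injective e) })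
  (λ { zero (suc k) _ p → first-β b x h k p ; (suc j) (suc k) (s<s l) → left-β j k l })
  (λ { zero () ; (suc j) e → last j (ℕ.suc-injective e) })
  where
  first-blocked : ∀ b x → isEmpty x ∨ (b ∧ βFree r) ≡ true → b ≡ false → x ≡ empty
  first-blocked b     empty _  _    = refl
  first-blocked false symα  () refl
  first-blocked false symβ  () refl
  first-β : ∀ b x → isEmpty x ∨ (b ∧ βFree r) ≡ true → ∀ k → lookup r k ≡ symβ → x ≡ empty
  first-β b    empty _ k p = refl
  first-β true symα  h k p = contradiction p (βFree-sound r h k)
  first-β true symβ  h k p = contradiction p (βFree-sound r h k)

fits-complete : ∀ {n} (bs : Vec Bool n) r → Fits bs r → fits bs r ≡ true
fits-complete [] (empty ∷ []) (isFit _ _ last) = contradiction refl (last zero refl)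
fits-complete [] (symα  ∷ []) _ = refl
fits-complete [] (symβ  ∷ []) _ = refl
fits-complete (b ∷ bs) (x ∷ r) (isFit blocked left-β last)
  rewrite fits-complete bs r (isFit (λ k j e → blocked (suc k) (suc j) (cong suc e))
                                    (λ j k l → left-β (suc j) (suc k) (s<s l))
                                    (λ j e → last (suc j) (cong suc e)))
  = first b x (blocked zero zero refl) (λ k → left-β zero (suc k) z<s)
  where
  first : ∀ b x → (b ≡ false → x ≡ empty) → (∀ k → lookup r k ≡ symβ → x ≡ empty) →
          isEmpty x ∨ (b ∧ βFree r) ≡ true
  first b     empty _ _ = refl
  first false symα  p _ with () ← p refl
  first false symβ  p _ with () ← p refl
  first true  symα  _ q = βFree-complete r λ k e → contradiction (q k e) λ ()
  first true  symβ  _ q = βFree-complete r λ k e → contradiction (q k e) λ ()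

-- The β-condition stays within one row, and the α-condition reaches the top row only through the
-- columns of `t` that contain an α. Hence the bits `αFree t` are all that the new row has to
-- respect.
isTableau-∷ : ∀ {n} (r : Vec Entry (suc n)) (t : Filling n) →
              IsTableau (r ∷ t) ⇔ (IsTableau t × fits (αFree t) r ≡ true)
isTableau-∷ {n} r t = mk⇔ to from
  where
  to : IsTableau (r ∷ t) → IsTableau t × fits (αFree t) r ≡ true
  to (isTableau above left diag) =
    isTableau (λ b b′ e l → above (below b) (below b′) e (s<s l))
              (λ b b′ e l → left (below b) (below b′) (cong suc e) l)
              (λ b e → diag (below b) (cong suc e)) ,
    fits-complete (αFree t) r (isFit
      (λ k j e f → let b , e′ , p = αFree-false t k f in
        above (zero , j) (below b) (cong suc (sym (trans e′ e))) (s<s z<s) p)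
      (λ j k l → left (zero , j) (zero , k) refl (s<s l))
      (λ j e → diag (zero , j) (cong (λ k → suc (suc k)) e)))

  from : IsTableau t × fits (αFree t) r ≡ true → IsTableau (r ∷ t)
  from (isTableau above left diag , h) with fits-sound (αFree t) r h
  ... | isFit blocked left-β last = isTableau above′ left′ diag′
    where
    above′ : ∀ b b′ → col b ≡ col b′ → row b ℕ.< row b′ →
             (r ∷ t) at b′ ≡ symα → (r ∷ t) at b ≡ empty
    above′ (zero , j) (zero , k) _ (s<s ()) _
    above′ (suc _ , _) (zero , k) _ (s<s ()) _
    above′ (suc i , j) (suc i′ , k) e (s<s l) p = above (i , j) (i′ , k) e l p
    above′ (zero , j) (suc i , k) e _ p with lookup (αFree t) k′ in eq
      where k′ = Data.Fin.Base.fromℕ< (ℕ.<-≤-trans (Fin.toℕ<n k) (ℕ.m∸n≤m n (toℕ i)))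
    ... | false = blocked _ j (trans (Fin.toℕ-fromℕ< _) (sym (ℕ.suc-injective e))) eq
    ... | true  = contradiction p (αFree-true t _ eq (i , k) (sym (Fin.toℕ-fromℕ< _)))

    left′ : ∀ b b′ → row b ≡ row b′ → col b ℕ.< col b′ →
            (r ∷ t) at b′ ≡ symβ → (r ∷ t) at b ≡ empty
    left′ (zero , j) (zero , k) _ (s<s l) = left-β j k l
    left′ (suc i , j) (suc i′ , k) e l = left (i , j) (i′ , k) (ℕ.suc-injective e) l

    diag′ : ∀ b → row b ℕ.+ col b ≡ suc (suc n) → (r ∷ t) at b ≢ empty
    diag′ (zero , j) e = last j (ℕ.suc-injective (ℕ.suc-injective e))
    diag′ (suc i , j) e = diag (i , j) (ℕ.suc-injective e)

-- Filtered sums depend only on the Boolean value of the test, so the equivalence is turned into an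
-- equation between Booleans, which can be used for rewriting.
does-∧ : ∀ {p q} {P : Set p} {Q : Set q} (P? : Dec P) (Q? : Dec Q) b →
         P ⇔ (Q × b ≡ true) → does P? ≡ does Q? ∧ b
does-∧ (yes p) (yes q) b     iff = sym (proj₂ (Equivalence.to iff p))
does-∧ (yes p) (no ¬q) b     iff = contradiction (proj₁ (Equivalence.to iff p)) ¬q
does-∧ (no ¬p) (yes q) true  iff = contradiction (Equivalence.from iff (q , refl)) ¬p
does-∧ (no ¬p) (yes q) false iff = refl
does-∧ (no ¬p) (no ¬q) b     iff = refl

does-isTableau-∷ : ∀ {n} (r : Vec Entry (suc n)) (t : Filling n) →
                   does (isTableau? (r ∷ t)) ≡ does (isTableau? t) ∧ fits (αFree t) r
does-isTableau-∷ r t = does-∧ (isTableau? (r ∷ t)) (isTableau? t) (fits (αFree t) r) (isTableau-∷ r t)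

#true : ∀ {n} → Vec Bool n → ℕ
#true []           = 0
#true (true  ∷ bs) = suc (#true bs)
#true (false ∷ bs) = #true bs

-- Binomial coefficients

nC0≡1 : ∀ n → n C 0 ≡ 1
nC0≡1 n = ≡.trans (nCk≡nC[n∸k] {0} {n} z≤n) (nCn≡1 n)

-- The absorption rule (k + 1) C(n, k + 1) = (n - k) C(n, k) without subtraction; induction by
-- Pascal's rule.
[k+1]*nC[k+1]+k*nCk≡n*nCk : ∀ n k → suc k ℕ.* (n C suc k) ℕ.+ k ℕ.* (n C k) ≡ n ℕ.* (n C k)
[k+1]*nC[k+1]+k*nCk≡n*nCk zero    zero    = ≡.refl
[k+1]*nC[k+1]+k*nCk≡n*nCk zero    (suc k) = ≡.cong₂ ℕ._+_ (ℕ.*-zeroʳ k) (ℕ.*-zeroʳ k)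
[k+1]*nC[k+1]+k*nCk≡n*nCk (suc n) zero    = begin
  1 ℕ.* (suc n C 1) ℕ.+ 0   ≡⟨ ≡.trans (ℕ.+-identityʳ _) (ℕ.*-identityˡ _) ⟩
  suc n C 1                 ≡⟨ nC1≡n (suc n) ⟩
  suc n                     ≡⟨ ℕ.*-identityʳ (suc n) ⟨
  suc n ℕ.* 1               ≡⟨ ≡.cong (suc n ℕ.*_) (nC0≡1 (suc n)) ⟨
  suc n ℕ.* (suc n C 0)     ∎
  where open ≡.≡-Reasoning
[k+1]*nC[k+1]+k*nCk≡n*nCk (suc n) (suc k) = begin
  suc (suc k) ℕ.* (suc n C suc (suc k)) ℕ.+ suc k ℕ.* (suc n C suc k)
    ≡⟨ ≡.cong₂ (λ x y → suc (suc k) ℕ.* x ℕ.+ suc k ℕ.* y) (nCk+nC[k+1]≡[n+1]C[k+1] n (suc k))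
        (nCk+nC[k+1]≡[n+1]C[k+1] n k) ⟨
  suc (suc k) ℕ.* (b ℕ.+ c) ℕ.+ suc k ℕ.* (a ℕ.+ b)
    ≡⟨ regroup k a b c ⟩
  (suc (suc k) ℕ.* c ℕ.+ suc k ℕ.* b) ℕ.+ (suc k ℕ.* b ℕ.+ k ℕ.* a) ℕ.+ (a ℕ.+ b)
    ≡⟨ ≡.cong₂ (λ x y → x ℕ.+ y ℕ.+ (a ℕ.+ b)) ([k+1]*nC[k+1]+k*nCk≡n*nCk n (suc k))
        ([k+1]*nC[k+1]+k*nCk≡n*nCk n k) ⟩
  n ℕ.* b ℕ.+ n ℕ.* a ℕ.+ (a ℕ.+ b)
    ≡⟨ collect n a b ⟩
  suc n ℕ.* (a ℕ.+ b)
    ≡⟨ ≡.cong (suc n ℕ.*_) (nCk+nC[k+1]≡[n+1]C[k+1] n k) ⟩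
  suc n ℕ.* (suc n C suc k) ∎
  where
  open ≡.≡-Reasoning
  a = n C k
  b = n C suc k
  c = n C suc (suc k)
  regroup : ∀ k a b c → suc (suc k) ℕ.* (b ℕ.+ c) ℕ.+ suc k ℕ.* (a ℕ.+ b) ≡
    (suc (suc k) ℕ.* c ℕ.+ suc k ℕ.* b) ℕ.+ (suc k ℕ.* b ℕ.+ k ℕ.* a) ℕ.+ (a ℕ.+ b)
  regroup = ℕ.solve-∀
  collect : ∀ n a b → n ℕ.* b ℕ.+ n ℕ.* a ℕ.+ (a ℕ.+ b) ≡ suc n ℕ.* (a ℕ.+ b)
  collect = ℕ.solve-∀

[j+1]*[k+j+1]Ck≡[k+j+1]*[k+j]Ck : ∀ k j →
    suc j ℕ.* (suc (k ℕ.+ j) C k) ≡ suc (k ℕ.+ j) ℕ.* ((k ℕ.+ j) C k)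
[j+1]*[k+j+1]Ck≡[k+j+1]*[k+j]Ck zero    j = ≡.cong (suc j ℕ.*_)
    (≡.trans (nC0≡1 (suc j)) (≡.sym (nC0≡1 j)))
[j+1]*[k+j+1]Ck≡[k+j+1]*[k+j]Ck (suc k) j = begin
  suc j ℕ.* (suc n C suc k)              ≡⟨ ≡.cong (suc j ℕ.*_) (nCk+nC[k+1]≡[n+1]C[k+1] n k) ⟨
  suc j ℕ.* (a ℕ.+ b)                    ≡⟨ ℕ.*-distribˡ-+ (suc j) a b ⟩
  suc j ℕ.* a ℕ.+ suc j ℕ.* b            ≡⟨ ≡.cong (ℕ._+ suc j ℕ.* b) absorb ⟨
  suc k ℕ.* b ℕ.+ suc j ℕ.* b            ≡⟨ ℕ.*-distribʳ-+ b (suc k) (suc j) ⟨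
  (suc k ℕ.+ suc j) ℕ.* b                ≡⟨ ≡.cong (ℕ._* b) (ℕ.+-suc (suc k) j) ⟩
  suc n ℕ.* b                            ∎
  where
  open ≡.≡-Reasoning
  n = suc k ℕ.+ j
  a = n C k
  b = n C suc k
  split : ∀ k j a → (suc k ℕ.+ j) ℕ.* a ≡ suc j ℕ.* a ℕ.+ k ℕ.* a
  split = ℕ.solve-∀
  absorb : suc k ℕ.* b ≡ suc j ℕ.* a
  absorb = ℕ.+-cancelʳ-≡ (k ℕ.* a) _ _ (≡.trans ([k+1]*nC[k+1]+k*nCk≡n*nCk n k) (split k j a))

nCk≤[n+1]Ck : ∀ n k → n C k ℕ.≤ suc n C k
nCk≤[n+1]Ck n zero    = ℕ.≤-reflexive (≡.trans (nC0≡1 n) (≡.sym (nC0≡1 (suc n))))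
nCk≤[n+1]Ck n (suc k) = ℕ.≤-trans (ℕ.m≤n+m _ (n C k)) (ℕ.≤-reflexive (nCk+nC[k+1]≡[n+1]C[k+1] n k))

-- The shape is dictated by the comparison of consecutive moments, whose binomials C(n - r, r) and
-- C(n - r - 1, r + 1) have different upper arguments.
[k+1]*nC[k+1]≤n*[n+1]Ck : ∀ n k → suc k ℕ.* (n C suc k) ℕ.≤ n ℕ.* (suc n C k)
[k+1]*nC[k+1]≤n*[n+1]Ck n k = ℕ.≤-trans
  (ℕ.≤-trans (ℕ.m≤m+n _ (k ℕ.* (n C k))) (ℕ.≤-reflexive ([k+1]*nC[k+1]+k*nCk≡n*nCk n k)))
  (ℕ.*-monoʳ-≤ n (nCk≤[n+1]Ck n k))

module RealAnalysis {c ℓ₁ ℓ₂ ℓ₃} (R : RealNumbers c ℓ₁ ℓ₂ ℓ₃) where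

  open RealNumbers R hiding (zero)
  open Probability R
  open CommutativeRing commutativeRing using (semiring; ring)
  open Algebra.Properties.Semiring.Exp semiring using (^-homo-*)
  open Algebra.Properties.Semiring.Mult semiring using (×-homo-+; ×1-homo-*)
  open Algebra.Properties.Ring ring using (-0#≈0#)
  open IntegerCoefficients commutativeRing
  open Relation.Binary.Reasoning.Setoid setoid
  open IsStrictPartialOrder isStrictPartialOrder
    using (<-respʳ-≈; <-respˡ-≈) renaming (trans to <-trans; irrefl to <-irrefl)

  -- Finite sums

  infixr 7 _⊙_

  _⊙_ : Bool → Carrier → Carrier
  b ⊙ x = if b then x else 0#

  ⊙-congˡ : ∀ b {x y} → x ≈ y → b ⊙ x ≈ b ⊙ y
  ⊙-congˡ true  eq = eq
  ⊙-congˡ false eq = ≈-refl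

  ⊙-*ˡ : ∀ b k x → k * (b ⊙ x) ≈ b ⊙ (k * x)
  ⊙-*ˡ true  k x = ≈-refl
  ⊙-*ˡ false k x = zeroʳ k

  module _ {a} {A : Set a} where

    ∑-cong : ∀ {f g : A → Carrier} → (∀ x → f x ≈ g x) → ∀ xs → ∑ xs f ≈ ∑ xs g
    ∑-cong eq []       = ≈-refl
    ∑-cong eq (x ∷ xs) = +-cong (eq x) (∑-cong eq xs)

    ∑-++ : ∀ xs ys (f : A → Carrier) → ∑ (xs ++ ys) f ≈ ∑ xs f + ∑ ys f
    ∑-++ []       ys f = ≈-sym (+-identityˡ _)
    ∑-++ (x ∷ xs) ys f = ≈-trans (+-congˡ (∑-++ xs ys f)) (≈-sym (+-assoc _ _ _))

    ∑-0 : ∀ (xs : List A) → ∑ xs (λ _ → 0#) ≈ 0#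
    ∑-0 []       = ≈-refl
    ∑-0 (x ∷ xs) = ≈-trans (+-identityˡ _) (∑-0 xs)

    ∑-+ : ∀ xs (f g : A → Carrier) → ∑ xs (λ x → f x + g x) ≈ ∑ xs f + ∑ xs g
    ∑-+ []       f g = ≈-sym (+-identityˡ _)
    ∑-+ (x ∷ xs) f g = ≈-trans (+-congˡ (∑-+ xs f g))
      (solve 4 (λ a b c d → (a :+ b) :+ (c :+ d) := (a :+ c) :+ (b :+ d)) ≈-refl _ _ _ _)

    ∑-*ˡ : ∀ k xs (f : A → Carrier) → ∑ xs (λ x → k * f x) ≈ k * ∑ xs f
    ∑-*ˡ k []       f = ≈-sym (zeroʳ k)
    ∑-*ˡ k (x ∷ xs) f = ≈-trans (+-congˡ (∑-*ˡ k xs f)) (≈-sym (distribˡ _ _ _))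

    ∑-⊙ : ∀ b xs (f : A → Carrier) → ∑ xs (λ x → b ⊙ f x) ≈ b ⊙ ∑ xs f
    ∑-⊙ true  xs f = ≈-refl
    ∑-⊙ false xs f = ∑-0 xs

    ∑-map : ∀ {b} {B : Set b} (g : B → A) xs (f : A → Carrier) → ∑ (map g xs) f ≡ ∑ xs (f ∘ g)
    ∑-map g []       f = ≡.refl
    ∑-map g (x ∷ xs) f = ≡.cong (f (g x) +_) (∑-map g xs f)

    ∑-filter : ∀ {p} {P : Pred A p} (P? : Decidable P) xs (f : A → Carrier) →
               ∑ (filter P? xs) f ≈ ∑ xs (λ x → does (P? x) ⊙ f x)
    ∑-filter P? []       f = ≈-refl
    ∑-filter P? (x ∷ xs) f with does (P? x)
    ... | true  = +-congˡ (∑-filter P? xs f)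
    ... | false = ≈-trans (∑-filter P? xs f) (≈-sym (+-identityˡ _))

  module _ {a b} {A : Set a} {B : Set b} where

    ∑-product : ∀ {d} {D : Set d} (g : A → B → D) xs ys (f : D → Carrier) →
                ∑ (cartesianProductWith g xs ys) f ≈ ∑ xs (λ x → ∑ ys (λ y → f (g x y)))
    ∑-product g []       ys f = ≈-refl
    ∑-product g (x ∷ xs) ys f = ≈-trans (∑-++ (map (g x) ys) _ f)
      (+-cong (reflexive (∑-map (g x) ys f)) (∑-product g xs ys f))

    ∑-swap : ∀ xs ys (f : A → B → Carrier) →
             ∑ xs (λ x → ∑ ys (f x)) ≈ ∑ ys (λ y → ∑ xs (λ x → f x y))
    ∑-swap []       ys f = ≈-sym (∑-0 ys)
    ∑-swap (x ∷ xs) ys f = ≈-trans (+-congˡ (∑-swap xs ys f)) (≈-sym (∑-+ ys (f x) _))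

  -- Sums over the rows that fit

  -- Two sums are needed because a non-empty box forbids a β to its right: splitting off the
  -- leftmost column of `rowSum` leaves `βFreeSum` whenever that box is filled, while `βFreeSum`
  -- reproduces itself.
  rowSum βFreeSum : ∀ {n} → Vec Bool n → (Vec Entry (suc n) → Carrier) → Carrier
  rowSum {n} bs f = ∑ (rows (suc n)) (λ r → fits bs r ⊙ f r)
  βFreeSum   {n} bs f = ∑ (rows (suc n)) (λ r → (fits bs r ∧ βFree r) ⊙ f r)

  ∑-tableaux : ∀ n (f : Filling (suc n) → Carrier) →
               ∑ (tableaux (suc n)) f ≈ ∑ (tableaux n) (λ t → rowSum (αFree t) (λ r → f (r ∷ t)))
  ∑-tableaux n f = begin
    ∑ (tableaux (suc n)) f
      ≈⟨ ∑-filter isTableau? (fillings (suc n)) f ⟩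
    ∑ (fillings (suc n)) (λ t → does (isTableau? t) ⊙ f t)
      ≈⟨ ∑-product _∷_ (rows (suc n)) (fillings n) _ ⟩
    ∑ (rows (suc n)) (λ r → ∑ (fillings n) (λ t → does (isTableau? (r ∷ t)) ⊙ f (r ∷ t)))
      ≈⟨ ∑-swap (rows (suc n)) (fillings n) _ ⟩
    ∑ (fillings n) (λ t → ∑ (rows (suc n)) (λ r → does (isTableau? (r ∷ t)) ⊙ f (r ∷ t)))
      ≈⟨ ∑-cong (λ t → ≈-trans (∑-cong (split t) (rows (suc n)))
          (∑-⊙ (does (isTableau? t)) (rows (suc n)) _)) (fillings n) ⟩
    ∑ (fillings n) (λ t → does (isTableau? t) ⊙ rowSum (αFree t) (λ r → f (r ∷ t)))
      ≈⟨ ∑-filter isTableau? (fillings n) _ ⟨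
    ∑ (tableaux n) (λ t → rowSum (αFree t) (λ r → f (r ∷ t))) ∎
    where
    split : ∀ t r → does (isTableau? (r ∷ t)) ⊙ f (r ∷ t) ≈
        does (isTableau? t) ⊙ fits (αFree t) r ⊙ f (r ∷ t)
    split t r rewrite does-isTableau-∷ r t with does (isTableau? t)
    ... | true  = ≈-refl
    ... | false = ≈-refl

  module _ {n} (bs : Vec Bool n) where

    rowSum-cong : ∀ {f g} → (∀ r → f r ≈ g r) → rowSum bs f ≈ rowSum bs g
    rowSum-cong eq = ∑-cong (λ r → ⊙-congˡ (fits bs r) (eq r)) (rows (suc n))

    βFreeSum-cong : ∀ {f g} → (∀ r → f r ≈ g r) → βFreeSum bs f ≈ βFreeSum bs g
    βFreeSum-cong eq = ∑-cong (λ r → ⊙-congˡ (fits bs r ∧ βFree r) (eq r)) (rows (suc n))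

    rowSum-*ˡ : ∀ k f → rowSum bs (λ r → k * f r) ≈ k * rowSum bs f
    rowSum-*ˡ k f = ≈-trans
      (∑-cong (λ r → ≈-sym (⊙-*ˡ (fits bs r) k (f r))) (rows (suc n)))
      (∑-*ˡ k (rows (suc n)) _)

    βFreeSum-*ˡ : ∀ k f → βFreeSum bs (λ r → k * f r) ≈ k * βFreeSum bs f
    βFreeSum-*ˡ k f = ≈-trans
      (∑-cong (λ r → ≈-sym (⊙-*ˡ (fits bs r ∧ βFree r) k (f r))) (rows (suc n)))
      (∑-*ˡ k (rows (suc n)) _)

    rowSum-∷ : ∀ b f → rowSum (b ∷ bs) f ≈
      rowSum bs (f ∘ (empty ∷_)) + b ⊙ (βFreeSum bs (f ∘ (symα ∷_)) + βFreeSum bs (f ∘ (symβ ∷_)))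
    rowSum-∷ b f = begin
      rowSum (b ∷ bs) f
        ≈⟨ ∑-product _∷_ entries (rows (suc n)) _ ⟩
      ∑ entries (λ x → ∑ (rows (suc n)) (λ r → fits (b ∷ bs) (x ∷ r) ⊙ f (x ∷ r)))
        ≈⟨ +-cong (∑-cong (λ r → reflexive
            (≡.cong (_⊙ f (empty ∷ r)) (Bool.∧-identityʳ (fits bs r)))) (rows (suc n)))
             (+-cong (nonempty symα b) (≈-trans (+-identityʳ _) (nonempty symβ b))) ⟩
      rowSum bs (f ∘ (empty ∷_)) + (b ⊙ βFreeSum bs (f ∘ (symα ∷_)) + b ⊙ βFreeSum bs (f ∘ (symβ ∷_)))
        ≈⟨ +-congˡ (⊙-+ b) ⟩
      rowSum bs (f ∘ (empty ∷_)) + b ⊙ (βFreeSum bs (f ∘ (symα ∷_)) + βFreeSum bs (f ∘ (symβ ∷_))) ∎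
      where
      nonempty : ∀ x b → ∑ (rows (suc n)) (λ r → (fits bs r ∧ (b ∧ βFree r)) ⊙ f (x ∷ r)) ≈
          b ⊙ βFreeSum bs (f ∘ (x ∷_))
      nonempty x true  = ≈-refl
      nonempty x false = ≈-trans
        (∑-cong (λ r → reflexive (≡.cong (_⊙ f (x ∷ r)) (Bool.∧-zeroʳ (fits bs r)))) (rows (suc n)))
        (∑-0 (rows (suc n)))
      ⊙-+ : ∀ b {x y} → b ⊙ x + b ⊙ y ≈ b ⊙ (x + y)
      ⊙-+ true  = ≈-refl
      ⊙-+ false = +-identityʳ 0#

    βFreeSum-∷ : ∀ b f → βFreeSum (b ∷ bs) f ≈
      βFreeSum bs (f ∘ (empty ∷_)) + b ⊙ βFreeSum bs (f ∘ (symα ∷_))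
    βFreeSum-∷ b f = begin
      βFreeSum (b ∷ bs) f
        ≈⟨ ∑-product _∷_ entries (rows (suc n)) _ ⟩
      ∑ entries (λ x → ∑ (rows (suc n)) (λ r → (fits (b ∷ bs) (x ∷ r) ∧ βFree (x ∷ r)) ⊙ f (x ∷ r)))
        ≈⟨ +-cong (∑-cong (λ r → reflexive
            (≡.cong (λ c → (c ∧ βFree r) ⊙ f (empty ∷ r)) (Bool.∧-identityʳ (fits bs r))))
            (rows (suc n)))
             (+-cong (withα b) (≈-trans (+-identityʳ _)
               (≈-trans (∑-cong (λ r → reflexive (≡.cong (_⊙ f (symβ ∷ r)) (Bool.∧-zeroʳ _)))
                   (rows (suc n))) (∑-0 (rows (suc n)))))) ⟩
      βFreeSum bs (f ∘ (empty ∷_)) + (b ⊙ βFreeSum bs (f ∘ (symα ∷_)) + 0#)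
        ≈⟨ +-congˡ (+-identityʳ _) ⟩
      βFreeSum bs (f ∘ (empty ∷_)) + b ⊙ βFreeSum bs (f ∘ (symα ∷_)) ∎
      where
      ∧-absorb : ∀ a b → (a ∧ b) ∧ b ≡ a ∧ b
      ∧-absorb a b = ≡.trans (Bool.∧-assoc a b b) (≡.cong (a ∧_) (Bool.∧-idem b))
      withα : ∀ b → ∑ (rows (suc n)) (λ r → ((fits bs r ∧ (b ∧ βFree r)) ∧ βFree r) ⊙ f (symα ∷ r))
          ≈ b ⊙ βFreeSum bs (f ∘ (symα ∷_))
      withα true  = ∑-cong (λ r →
          reflexive (≡.cong (_⊙ f (symα ∷ r)) (∧-absorb (fits bs r) (βFree r)))) (rows (suc n))
      withα false = ≈-trans
        (∑-cong (λ r → reflexive (≡.cong (λ c → (c ∧ βFree r) ⊙ f (symα ∷ r))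
            (Bool.∧-zeroʳ (fits bs r)))) (rows (suc n)))
        (∑-0 (rows (suc n)))

  rowSum-[] : ∀ f → rowSum [] f ≈ f (symα ∷ []) + f (symβ ∷ [])
  rowSum-[] f = ≈-trans (+-identityˡ _) (+-congˡ (+-identityʳ _))

  βFreeSum-[] : ∀ f → βFreeSum [] f ≈ f (symα ∷ [])
  βFreeSum-[] f = ≈-trans (+-identityˡ _) (≈-trans (+-congˡ (+-identityˡ _)) (+-identityʳ _))

  -- Natural numbers, index ranges and signs

  fromℕ-+ : ∀ m n → fromℕ (m ℕ.+ n) ≈ fromℕ m + fromℕ n
  fromℕ-+ = ×-homo-+ 1#

  fromℕ-* : ∀ m n → fromℕ (m ℕ.* n) ≈ fromℕ m * fromℕ n
  fromℕ-* = ×1-homo-*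

  fromℕ-1 : fromℕ 1 ≈ 1#
  fromℕ-1 = +-identityʳ 1#

  1^ : ∀ n → 1# ^ n ≈ 1#
  1^ zero    = ≈-refl
  1^ (suc n) = ≈-trans (*-identityˡ _) (1^ n)

  ∑-upTo : ∀ n f → ∑ (upTo (suc n)) f ≈ f 0 + ∑ (upTo n) (f ∘ suc)
  ∑-upTo n f = +-congˡ (reflexive
      (≡.trans (≡.cong (λ xs → ∑ xs f) (≡.sym (List.map-upTo suc n))) (∑-map suc (upTo n) f)))

  ∑-upTo-drop : ∀ k n f → (∀ r → r ℕ.< k → f r ≈ 0#) →
      ∑ (upTo (k ℕ.+ n)) f ≈ ∑ (upTo n) (λ j → f (k ℕ.+ j))
  ∑-upTo-drop zero    n f zeros = ≈-refl
  ∑-upTo-drop (suc k) n f zeros = ≈-trans (∑-upTo (k ℕ.+ n) f) (≈-trans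
    (+-cong (zeros 0 z<s) (∑-upTo-drop k n (f ∘ suc) (λ r l → zeros (suc r) (s<s l)))) (+-identityˡ _))

  sign : ℕ → Carrier
  sign zero    = 1#
  sign (suc j) = - sign j

  -- Order and limits

  <⇒0<- : ∀ {x y} → x < y → 0# < y - x
  <⇒0<- {x} {y} x<y = <-respˡ-≈ (-‿inverseˡ x) (<-respʳ-≈ (+-comm _ _) (+-monoʳ-< (- x) x<y))

  <-by : ∀ {x y w} → 0# < w → w ≈ y - x → x < y
  <-by {x} {y} 0<w eq = <-respˡ-≈ (+-identityʳ x) (<-respʳ-≈
    (≈-trans (+-congˡ eq) (solve 2 (λ x y → x :+ (y :- x) := y) ≈-refl x y)) (+-monoʳ-< x 0<w))

  +-mono-< : ∀ {w x y z} → w < x → y < z → w + y < x + z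
  +-mono-< p q = <-by (+-positive (<⇒0<- p) (<⇒0<- q))
    (solve 4 (λ w x y z → (x :- w) :+ (z :- y) := x :+ z :- (w :+ y)) ≈-refl _ _ _ _)

  -- Cotransitivity of apartness, made directional; it takes the place of trichotomy.
  <-cotrans : ∀ {x y} → x < y → ∀ z → x < z ⊎ z < y
  <-cotrans x<y z with #-cotrans (<⇒# x<y) z
  ... | inj₁ x#z with #⇒<⊎> x#z
  ...   | inj₁ x<z = inj₁ x<z
  ...   | inj₂ z<x = inj₂ (<-trans z<x x<y)
  <-cotrans x<y z | inj₂ z#y with #⇒<⊎> z#y
  ...   | inj₁ z<y = inj₂ z<y
  ...   | inj₂ y<z = inj₁ (<-trans x<y y<z)

  -- Placing w in the gap between 0 and w + w yields either 0 < w or w < w + w, and the latter gives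
  -- the claim after subtracting w.
  half-positive : ∀ {w} → 0# < w + w → 0# < w
  half-positive {w} p with <-cotrans p w
  ... | inj₁ 0<w   = 0<w
  ... | inj₂ w<w+w = <-by (<⇒0<- w<w+w) (solve 1 (λ w → w :+ w :- w := w :- :0) ≈-refl w)

  recip : ∀ y → 0# < y → Carrier
  recip y = divide 1# y

  *-recip : ∀ y (0<y : 0# < y) → y * recip y 0<y ≈ 1#
  *-recip y 0<y = ≈-trans (*-cong (solve 1 (λ y → y := y :- :0) ≈-refl y) (*-identityˡ _))
    (proj₂ (proj₂ (#⇒invertible (#-sym (<⇒# 0<y)))))

  divide-recip : ∀ x y (0<y : 0# < y) → divide x y 0<y ≈ x * recip y 0<y
  divide-recip x y 0<y = *-congˡ (≈-sym (*-identityˡ _))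

  recip-unique : ∀ {y} (0<y : 0# < y) {u} → y * u ≈ 1# → u ≈ recip y 0<y
  recip-unique {y} 0<y {u} eq = begin
    u                       ≈⟨ *-identityʳ u ⟨
    u * 1#                  ≈⟨ *-congˡ (*-recip y 0<y) ⟨
    u * (y * recip y 0<y)   ≈⟨ solve 3 (λ u y r → u :* (y :* r) := y :* u :* r) ≈-refl _ _ _ ⟩
    y * u * recip y 0<y     ≈⟨ *-congʳ eq ⟩
    1# * recip y 0<y        ≈⟨ *-identityˡ _ ⟩
    recip y 0<y             ∎

  recip-positive : ∀ y (0<y : 0# < y) → 0# < recip y 0<y
  recip-positive y 0<y with #⇒<⊎> (#-sym (invertible⇒# {recip y 0<y} {0#}
    (y , ≈-trans (*-congˡ minus0) (*-recip y 0<y) ,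
        ≈-trans (*-congʳ minus0) (≈-trans (*-comm _ _) (*-recip y 0<y)))))
    where
    minus0 : ∀ {x} → x - 0# ≈ x
    minus0 = solve 1 (λ x → x :- :0 := x) ≈-refl _
  ... | inj₁ 0<r = 0<r
  -- A negative reciprocal r would make y (0 - r) = -1 positive.
  ... | inj₂ r<0 = contradiction
    (<-trans 0<1 (<-by (*-positive 0<y (<⇒0<- r<0))
      (≈-trans (solve 2 (λ y r → y :* (:0 :- r) := :0 :- y :* r) ≈-refl _ _)
        (+-congˡ (-‿cong (*-recip y 0<y))))))
    (<-irrefl ≈-refl)

  *-cancel-positive : ∀ {a w} → 0# < a → 0# < a * w → 0# < w
  *-cancel-positive {a} {w} 0<a p = <-respʳ-≈
    (≈-trans (solve 3 (λ a r w → r :* (a :* w) := a :* r :* w) ≈-refl a (recip a 0<a) w)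
      (≈-trans (*-congʳ (*-recip a 0<a)) (*-identityˡ w)))
    (*-positive (recip-positive a 0<a) p)

  -- Constructively stronger than 0# ≤ x, but closed under multiplication.
  Nonnegative : Carrier → Set _
  Nonnegative x = x ≈ 0# ⊎ 0# < x

  nonnegative-resp : ∀ {x y} → x ≈ y → Nonnegative x → Nonnegative y
  nonnegative-resp eq (inj₁ z) = inj₁ (≈-trans (≈-sym eq) z)
  nonnegative-resp eq (inj₂ p) = inj₂ (<-respʳ-≈ eq p)

  nonnegative-+ : ∀ {x y} → Nonnegative x → Nonnegative y → Nonnegative (x + y)
  nonnegative-+ (inj₁ p) q        = nonnegative-resp
      (≈-trans (≈-sym (+-identityˡ _)) (+-congʳ (≈-sym p))) q
  nonnegative-+ (inj₂ p) (inj₁ q) = inj₂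
      (<-respʳ-≈ (≈-trans (≈-sym (+-identityʳ _)) (+-congˡ (≈-sym q))) p)
  nonnegative-+ (inj₂ p) (inj₂ q) = inj₂ (+-positive p q)

  nonnegative-* : ∀ {x y} → Nonnegative x → Nonnegative y → Nonnegative (x * y)
  nonnegative-* (inj₁ p) q        = inj₁ (≈-trans (*-congʳ p) (zeroˡ _))
  nonnegative-* (inj₂ p) (inj₁ q) = inj₁ (≈-trans (*-congˡ q) (zeroʳ _))
  nonnegative-* (inj₂ p) (inj₂ q) = inj₂ (*-positive p q)

  nonnegative-fromℕ : ∀ n → Nonnegative (fromℕ n)
  nonnegative-fromℕ zero    = inj₁ ≈-refl
  nonnegative-fromℕ (suc n) = inj₂ (fromℕ-positive (suc n))

  positive-+ : ∀ {x y} → 0# < x → Nonnegative y → 0# < x + y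
  positive-+ p (inj₁ q) = <-respʳ-≈ (≈-trans (≈-sym (+-identityʳ _)) (+-congˡ (≈-sym q))) p
  positive-+ p (inj₂ q) = +-positive p q

  infix 4 ∣_∣<_

  ∣_∣<_ : Carrier → Carrier → Set _
  ∣ x ∣< ε = x < ε × - x < ε

  ∣∣<-resp : ∀ {x y ε} → x ≈ y → ∣ x ∣< ε → ∣ y ∣< ε
  ∣∣<-resp eq (p , q) = <-respˡ-≈ eq p , <-respˡ-≈ (-‿cong eq) q

  ∣∣<-respʳ : ∀ {x ε δ} → ε ≈ δ → ∣ x ∣< ε → ∣ x ∣< δ
  ∣∣<-respʳ eq (p , q) = <-respʳ-≈ eq p , <-respʳ-≈ eq q

  within : ∀ {ε x y} → ∣ x - y ∣< ε → Within ε x y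
  within (p , q) = p , <-respˡ-≈ (solve 2 (λ x y → :- (x :- y) := y :- x) ≈-refl _ _) q

  unwithin : ∀ {ε x y} → Within ε x y → ∣ x - y ∣< ε
  unwithin (p , q) = p , <-respˡ-≈ (solve 2 (λ x y → y :- x := :- (x :- y)) ≈-refl _ _) q

  ∣∣<-+ : ∀ {x y ε δ} → ∣ x ∣< ε → ∣ y ∣< δ → ∣ x + y ∣< ε + δ
  ∣∣<-+ (p , q) (r , s) = +-mono-< p r ,
    <-respˡ-≈ (solve 2 (λ x y → :- x :+ :- y := :- (x :+ y)) ≈-refl _ _) (+-mono-< q s)

  -- 2 (A B ∓ a b) = (A - a) (B ± b) + (A + a) (B ∓ b)
  ∣∣<-* : ∀ {a b A B} → ∣ a ∣< A → ∣ b ∣< B → ∣ a * b ∣< A * B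
  ∣∣<-* {a} {b} {A} {B} (a<A , -a<A) (b<B , -b<B) =
    <-by (half-positive (<-respʳ-≈
      (solve 4 (λ a b A B → (A :- a) :* (B :- :- b) :+ (A :- :- a) :* (B :- b)
                            := (A :* B :- a :* b) :+ (A :* B :- a :* b)) ≈-refl a b A B)
      (+-positive (*-positive (<⇒0<- a<A) (<⇒0<- -b<B)) (*-positive (<⇒0<- -a<A) (<⇒0<- b<B)))))
          ≈-refl ,
    <-by (half-positive (<-respʳ-≈
      (solve 4 (λ a b A B → (A :- a) :* (B :- b) :+ (A :- :- a) :* (B :- :- b)
                            := (A :* B :- :- (a :* b)) :+ (A :* B :- :- (a :* b))) ≈-refl a b A B)
      (+-positive (*-positive (<⇒0<- a<A) (<⇒0<- b<B)) (*-positive (<⇒0<- -a<A) (<⇒0<- -b<B))))) ≈-refl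

  0<⇒-< : ∀ {x ε} → 0# < x → 0# < ε → - x < ε
  0<⇒-< p q = <-by (+-positive q p) (solve 2 (λ x e → e :+ x := e :- :- x) ≈-refl _ _)

  nonnegative-∣∣< : ∀ {x ε} → Nonnegative x → x < ε → ∣ x ∣< ε
  nonnegative-∣∣< (inj₁ x≈0) x<ε = x<ε ,
      <-respˡ-≈ (≈-trans x≈0 (≈-trans (≈-sym -0#≈0#) (-‿cong (≈-sym x≈0)))) x<ε
  nonnegative-∣∣< (inj₂ 0<x) x<ε = x<ε , 0<⇒-< 0<x (<-trans 0<x x<ε)

  within-refl : ∀ {x y ε} → x ≈ y → 0# < ε → Within ε x y
  within-refl {x} {y} eq p = <-respˡ-≈ (≈-sym (≈-trans (+-congʳ eq) (-‿inverseʳ y))) p ,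
                             <-respˡ-≈ (≈-sym (≈-trans (+-congʳ (≈-sym eq)) (-‿inverseʳ x))) p

  within-resp : ∀ {x x′ y y′ ε} → x ≈ x′ → y ≈ y′ → Within ε x y → Within ε x′ y′
  within-resp p q (r , s) = <-respˡ-≈ (+-cong p (-‿cong q)) r , <-respˡ-≈ (+-cong q (-‿cong p)) s

  within-sym : ∀ {x y ε} → Within ε x y → Within ε y x
  within-sym (p , q) = q , p

  within-trans : ∀ {x y z ε δ} → Within ε x y → Within δ y z → Within (ε + δ) x z
  within-trans p q = within (∣∣<-resp (solve 3 (λ x y z → (x :- y) :+ (y :- z) := x :- z) ≈-refl _ _ _)
    (∣∣<-+ (unwithin p) (unwithin q)))

  within-respε : ∀ {x y ε δ} → ε ≈ δ → Within ε x y → Within δ x y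
  within-respε eq (p , q) = <-respʳ-≈ eq p , <-respʳ-≈ eq q

  fraction : ∀ {A ε} → 0# < A → 0# < ε → ∃[ δ ] 0# < δ × A * δ ≈ ε
  fraction {A} {ε} 0<A 0<ε = ε * recip A 0<A , *-positive 0<ε (recip-positive A 0<A) ,
    ≈-trans (solve 3 (λ a e r → a :* (e :* r) := e :* (a :* r)) ≈-refl _ _ _)
      (≈-trans (*-congˡ (*-recip A 0<A)) (*-identityʳ _))

  half : ∀ {ε} → 0# < ε → ∃[ δ ] 0# < δ × δ + δ ≈ ε
  half 0<ε = let δ , 0<δ , eq = fraction (+-positive 0<1 0<1) 0<ε in
    δ , 0<δ , ≈-trans (solve 1 (λ d → d :+ d := (:1 :+ :1) :* d) ≈-refl δ) eq

  ∃-bound : ∀ x → ∃[ A ] 0# < A × ∣ x ∣< A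
  ∃-bound x with archimedean x | archimedean (- x)
  ... | m , p | n , q = fromℕ (suc (m ℕ.+ n)) , fromℕ-positive (suc (m ℕ.+ n)) ,
    <-by (positive-+ (positive-+ 0<1 (nonnegative-fromℕ n)) (inj₂ (<⇒0<- p)))
      (≈-trans (solve 3 (λ x m n → :1 :+ n :+ (m :- x) := :1 :+ (m :+ n) :- x) ≈-refl _ _ _)
        (+-congʳ (+-congˡ (≈-sym (fromℕ-+ m n))))) ,
    <-by (positive-+ (positive-+ 0<1 (nonnegative-fromℕ m)) (inj₂ (<⇒0<- q)))
      (≈-trans (solve 3 (λ x m n → :1 :+ m :+ (n :- :- x) := :1 :+ (m :+ n) :- :- x) ≈-refl _ _ _)
        (+-congʳ (+-congˡ (≈-sym (fromℕ-+ m n)))))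

  fromℕ-exceeds : ∀ {ε} → 0# < ε → ∃[ N ] ∀ n → N ℕ.≤ n → 1# < fromℕ n * ε
  fromℕ-exceeds {ε} 0<ε with archimedean (recip ε 0<ε)
  ... | N , p = N , λ n N≤n → <-by
    (positive-+ (*-positive 0<ε (<⇒0<- p)) (nonnegative-* (nonnegative-fromℕ (n ∸ N)) (inj₂ 0<ε)))
    (≈-trans (solve 4 (λ e a r b → e :* (a :- r) :+ b :* e := (a :+ b) :* e :- e :* r) ≈-refl ε
        (fromℕ N) (recip ε 0<ε) (fromℕ (n ∸ N)))
      (+-cong (*-congʳ (≈-trans (≈-sym (fromℕ-+ N (n ∸ N)))
          (reflexive (≡.cong fromℕ (ℕ.m+[n∸m]≡n N≤n)))))
              (-‿cong (*-recip ε 0<ε))))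

  ⟶-resp : ∀ {s t a b} → (∀ n → s n ≈ t n) → a ≈ b → s ⟶ a → t ⟶ b
  ⟶-resp eq eq′ lim ε 0<ε with lim ε 0<ε
  ... | N , h = N , λ n N≤n → within-resp (eq n) eq′ (h n N≤n)

  ⟶-const : ∀ a → (λ _ → a) ⟶ a
  ⟶-const a ε 0<ε = 0 , λ _ _ → within-refl ≈-refl 0<ε

  ⟶-+ : ∀ {s t a b} → s ⟶ a → t ⟶ b → (λ n → s n + t n) ⟶ a + b
  ⟶-+ limₛ limₜ ε 0<ε =
    let δ , 0<δ , eq = half 0<ε
        M , h        = limₛ δ 0<δ
        N , k        = limₜ δ 0<δ
    in M ℕ.⊔ N , λ n l → within (∣∣<-respʳ eq
      (∣∣<-resp (solve 4 (λ s a t b → (s :- a) :+ (t :- b) := (s :+ t) :- (a :+ b)) ≈-refl _ _ _ _)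
        (∣∣<-+ (unwithin (h n (ℕ.m⊔n≤o⇒m≤o M N l))) (unwithin (k n (ℕ.m⊔n≤o⇒n≤o M N l))))))

  ⟶-* : ∀ {s t a b} → s ⟶ a → t ⟶ b → (λ n → s n * t n) ⟶ a * b
  ⟶-* {s} {t} {a} {b} limₛ limₜ ε 0<ε =
    let A , 0<A , ∣a∣<A = ∃-bound a
        B , 0<B , ∣b∣<B = ∃-bound b
        -- Eventually |s n| < A + 1, and s t - a b = s (t - b) + (s - a) b, so the error stays below
        -- (A + 1) δ + δ B.
        δ , 0<δ , eq    = fraction (+-positive (+-positive 0<A 0<1) 0<B) 0<ε
        L , g           = limₛ 1# 0<1
        M , h           = limₛ δ 0<δ
        N , k           = limₜ δ 0<δ
    in L ℕ.⊔ (M ℕ.⊔ N) , λ n l →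
      let l′      = ℕ.m⊔n≤o⇒n≤o L (M ℕ.⊔ N) l
          ∣s∣<A+1 = ∣∣<-resp (solve 2 (λ a s → a :+ (s :- a) := s) ≈-refl a (s n))
                      (∣∣<-+ ∣a∣<A (unwithin (g n (ℕ.m⊔n≤o⇒m≤o L (M ℕ.⊔ N) l))))
      in within (∣∣<-respʳ
        (≈-trans (solve 3 (λ x d y → x :* d :+ d :* y := (x :+ y) :* d) ≈-refl (A + 1#) δ B) eq)
        (∣∣<-resp (solve 4 (λ s t a b → s :* (t :- b) :+ (s :- a) :* b := s :* t :- a :* b) ≈-refl
            (s n) (t n) a b)
          (∣∣<-+ (∣∣<-* ∣s∣<A+1 (unwithin (k n (ℕ.m⊔n≤o⇒n≤o M N l′))))
                 (∣∣<-* (unwithin (h n (ℕ.m⊔n≤o⇒m≤o M N l′))) ∣b∣<B))))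

  ⟶-unshift : ∀ {s a} → (λ n → s (suc n)) ⟶ a → s ⟶ a
  ⟶-unshift lim ε 0<ε with lim ε 0<ε
  ... | N , h = suc N , λ { (suc n) (s≤s l) → h n l }

  ⟶-eventually : ∀ {s t a} K → (∀ n → K ℕ.≤ n → s n ≈ t n) → s ⟶ a → t ⟶ a
  ⟶-eventually K eq lim ε 0<ε with lim ε 0<ε
  ... | N , h = K ℕ.⊔ N , λ n l →
      within-resp (eq n (ℕ.m⊔n≤o⇒m≤o K N l)) ≈-refl (h n (ℕ.m⊔n≤o⇒n≤o K N l))

  ⟶-∑ : ∀ {a} {A : Set a} (xs : List A) {s : ℕ → A → Carrier} {l : A → Carrier} →
        (∀ x → (λ n → s n x) ⟶ l x) → (λ n → ∑ xs (s n)) ⟶ ∑ xs l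
  ⟶-∑ []       lim = ⟶-const 0#
  ⟶-∑ (x ∷ xs) lim = ⟶-+ (lim x) (⟶-∑ xs lim)

  -- Interchange of two limits: the index m is fixed from ε before n is considered, large enough
  -- both for the uniform approximation and for l m to be close to a.
  ⟶-uniform : ∀ {s : ℕ → Carrier} {t : ℕ → ℕ → Carrier} {l : ℕ → Carrier} {a} →
    (∀ ε → 0# < ε → ∃[ M ] ∀ m → M ℕ.≤ m → ∀ n → Within ε (s n) (t m n)) →
    (∀ m → t m ⟶ l m) → l ⟶ a → s ⟶ a
  ⟶-uniform unif lim limₗ ε 0<ε =
    let δ , 0<δ , eq  = half 0<ε
        η , 0<η , eq′ = half 0<δ
        M , g         = unif η 0<η
        L , k         = limₗ δ 0<δ
        N , h         = lim (M ℕ.⊔ L) η 0<η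
    in N , λ n N≤n → within-respε eq (within-trans
      (within-respε eq′ (within-trans (g (M ℕ.⊔ L) (ℕ.m≤m⊔n M L) n) (h n N≤n)))
      (k (M ℕ.⊔ L) (ℕ.m≤n⊔m M L)))

  -- Alternating sums

  alternating : (ℕ → Carrier) → ℕ → Carrier
  alternating u n = ∑ (upTo n) (λ j → sign j * u j)

  alternating-suc : ∀ u n → alternating u (suc n) ≈ u 0 - alternating (u ∘ suc) n
  alternating-suc u n = ≈-trans (∑-upTo n _) (+-cong (*-identityˡ _) (≈-trans
    (∑-cong (λ j → solve 2 (λ s x → :- s :* x := :- :1 :* (s :* x)) ≈-refl _ _) (upTo n))
    (≈-trans (∑-*ˡ (- 1#) (upTo n) _) (solve 1 (λ x → :- :1 :* x := :- x) ≈-refl _))))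

  -- A class containing the model sequence 1 / j!, with equality in `decay` and `initial`, and the
  -- sequences that express the laws for every size. All truncation estimates are derived from these
  -- three conditions.
  record FastDecay (u : ℕ → Carrier) : Set (c ⊔ ℓ₁ ⊔ ℓ₃) where
    field
      nonnegative : ∀ j → Nonnegative (u j)
      decay       : ∀ j → Nonnegative (u j - fromℕ (suc j) * u (suc j))
      initial     : Nonnegative (1# - u 0)

    antitone : ∀ j → Nonnegative (u j - u (suc j))
    antitone j = nonnegative-resp
      (solve 3 (λ x n y → x :- (:1 :+ n) :* y :+ n :* y := x :- y) ≈-refl _ _ _)
      (nonnegative-+ (decay j) (nonnegative-* (nonnegative-fromℕ j) (nonnegative (suc j))))

    ≤1 : ∀ j → Nonnegative (1# - u j)
    ≤1 zero    = initial
    ≤1 (suc j) = nonnegative-resp (solve 3 (λ o x y → o :- x :+ (x :- y) := o :- y) ≈-refl _ _ _)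
      (nonnegative-+ (≤1 j) (antitone j))

    j*u≤1 : ∀ j → Nonnegative (1# - fromℕ j * u j)
    j*u≤1 zero    = inj₂ (<-respʳ-≈ (solve 1 (λ x → :1 := :1 :- :0 :* x) ≈-refl (u 0)) 0<1)
    j*u≤1 (suc j) = nonnegative-resp (solve 3 (λ o x y → o :- x :+ (x :- y) := o :- y) ≈-refl _ _ _)
      (nonnegative-+ (≤1 j) (decay j))

    small : ∀ {ε} j → 1# < fromℕ j * ε → u j < ε
    small zero    p = contradiction (<-trans 0<1 (<-respʳ-≈ (zeroˡ _) p)) (<-irrefl ≈-refl)
    small (suc j) p = <-by (*-cancel-positive (fromℕ-positive (suc j)) (<-respʳ-≈
      (solve 4 (λ n e o x → n :* e :- o :+ (o :- n :* x) := n :* (e :- x)) ≈-refl _ _ _ _)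
      (positive-+ (<⇒0<- p) (j*u≤1 (suc j))))) ≈-refl

  -- The Leibniz bounds. Splitting off the first term replaces the sum by u 0 minus the sum of the
  -- shifted sequence, so each bound at `suc n` comes from the opposite one at `n`.
  alternating-bounds : ∀ {u} → (∀ j → Nonnegative (u j)) → (∀ j → Nonnegative (u j - u (suc j))) → ∀ n →
                       Nonnegative (alternating u n) × Nonnegative (u 0 - alternating u n)
  alternating-bounds {u} u≥0 u↓ zero =
    inj₁ ≈-refl , nonnegative-resp (solve 1 (λ x → x := x :- :0) ≈-refl _) (u≥0 0)
  alternating-bounds {u} u≥0 u↓ (suc n) with alternating-bounds (u≥0 ∘ suc) (u↓ ∘ suc) n
  ... | lower , upper =
    nonnegative-resp (≈-trans (solve 3 (λ x y z → x :- y :+ (y :- z) := x :- z) ≈-refl _ _ _)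
        (≈-sym (alternating-suc u n)))
      (nonnegative-+ (u↓ 0) upper) ,
    nonnegative-resp (≈-trans (solve 2 (λ x y → y := x :- (x :- y)) ≈-refl (u 0) _)
        (+-congˡ (-‿cong (≈-sym (alternating-suc u n))))) lower

  -- Removing the m common terms changes at most the sign of the difference; what remains is an
  -- alternating sum lying between 0 and its first term u m.
  alternating-tail : ∀ {u} → (∀ j → Nonnegative (u j)) → (∀ j → Nonnegative (u j - u (suc j))) →
                     ∀ {ε} m n → u m < ε → Within ε (alternating u (m ℕ.+ n)) (alternating u m)
  alternating-tail {u} u≥0 u↓ zero n u<ε with alternating-bounds u≥0 u↓ n
  ... | lower , upper = within (∣∣<-resp (solve 1 (λ x → x := x :- :0) ≈-refl _)
    (nonnegative-∣∣< lower (<-by (positive-+ (<⇒0<- u<ε) upper)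
      (solve 3 (λ e x y → e :- x :+ (x :- y) := e :- y) ≈-refl _ _ _))))
  alternating-tail {u} u≥0 u↓ (suc m) n u<ε =
    within-resp (≈-sym (alternating-suc u (m ℕ.+ n))) (≈-sym (alternating-suc u m))
      (within (∣∣<-resp (solve 3 (λ x y z → y :- z := (x :- z) :- (x :- y)) ≈-refl _ _ _)
        (unwithin (within-sym (alternating-tail (u≥0 ∘ suc) (u↓ ∘ suc) m n u<ε)))))

  -- M is chosen before u: fast decay gives j (u j) ≤ 1, hence u j < ε as soon as 1 < j ε, for all
  -- such u at once. This is the uniformity in the size of the tableau.
  fastDecay-tail : ∀ {ε} → 0# < ε → ∃[ M ] ∀ m → M ℕ.≤ m → ∀ {u} → FastDecay u → ∀ n →
                   Within ε (alternating u (m ℕ.+ n)) (alternating u m)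
  fastDecay-tail 0<ε = let M , h = fromℕ-exceeds 0<ε in
    M , λ m M≤m fd n → alternating-tail (FastDecay.nonnegative fd) (FastDecay.antitone fd) m n
      (FastDecay.small fd m (h m M≤m))

  -- Inverse factorials and the exponential series at -1

  inverse! : ℕ → Carrier
  inverse! k = recip (fromℕ (k !)) (fromℕ-positive (k !) {{k ℕ.!≢0}})

  inverse!-0 : inverse! 0 ≈ 1#
  inverse!-0 = ≈-sym (recip-unique _ (≈-trans (*-identityʳ _) fromℕ-1))

  inverse!-suc : ∀ k → fromℕ (suc k) * inverse! (suc k) ≈ inverse! k
  inverse!-suc k = recip-unique _ (begin
    fromℕ (k !) * (fromℕ (suc k) * inverse! (suc k))
      ≈⟨ solve 3 (λ a b d → a :* (b :* d) := b :* a :* d) ≈-refl _ _ _ ⟩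
    fromℕ (suc k) * fromℕ (k !) * inverse! (suc k)
      ≈⟨ *-congʳ (fromℕ-* (suc k) (k !)) ⟨
    fromℕ (suc k !) * inverse! (suc k)
      ≈⟨ *-recip _ _ ⟩
    1# ∎)

  expTerm-1 : ∀ k → expTerm 1# k ≈ inverse! k
  expTerm-1 k = ≈-trans (divide-recip _ _ _) (≈-trans (*-congʳ (1^ k)) (*-identityˡ _))

  expTerm--1 : ∀ k → expTerm (- 1#) k ≈ sign k * inverse! k
  expTerm--1 k = ≈-trans (divide-recip _ _ _) (*-congʳ (power k))
    where
    power : ∀ k → (- 1#) ^ k ≈ sign k
    power zero    = ≈-refl
    power (suc k) = ≈-trans (*-congˡ (power k)) (solve 1 (λ s → :- :1 :* s := :- s) ≈-refl _)

  inverse!-fastDecay : FastDecay inverse!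
  inverse!-fastDecay = record
    { nonnegative = λ j → inj₂ (recip-positive _ _)
    ; decay       = λ j → inj₁ (≈-trans (+-congˡ (-‿cong (inverse!-suc j))) (-‿inverseʳ _))
    ; initial     = inj₁ (≈-trans (+-congˡ (-‿cong inverse!-0)) (-‿inverseʳ _))
    }

  alternating-cauchy : ∀ {u} → FastDecay u → Cauchy (alternating u)
  alternating-cauchy {u} fd ε 0<ε =
    let δ , 0<δ , eq = half 0<ε
        M , h        = fastDecay-tail 0<δ
        near : ∀ n → M ℕ.≤ n → Within δ (alternating u n) (alternating u M)
        near n M≤n = ≡.subst (λ i → Within δ (alternating u i) (alternating u M)) (ℕ.m+[n∸m]≡n M≤n)
                       (h M ℕ.≤-refl fd (n ∸ M))
    in M , λ m n M≤m M≤n → within-respε eq (within-trans (near m M≤m) (within-sym (near n M≤n)))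

  -- The number e exists by completeness. Its limit is recorded in two forms, for the exponential
  -- series and for the alternating sum that the laws converge to.
  exp-1 : ∃[ e ] IsExp (- 1#) e × alternating inverse! ⟶ e
  exp-1 = let e , lim = complete _ (alternating-cauchy inverse!-fastDecay) in
    e , ⟶-resp (λ n → ∑-cong (λ k → ≈-sym (expTerm--1 k)) (upTo n)) ≈-refl lim , lim

  -- Induction on j: multiplying by (j + 1) times its reciprocal allows the absorption rule to lower
  -- C(k + j + 1, k) while the recursion of 1 / j! lowers the factorials.
  binomial-inverse! : ∀ k j → fromℕ ((k ℕ.+ j) C k) * inverse! (k ℕ.+ j) ≈ inverse! k * inverse! j
  binomial-inverse! k zero rewrite ℕ.+-identityʳ k | nCn≡1 k =
    ≈-trans (*-congʳ fromℕ-1) (≈-trans (*-comm _ _) (*-congˡ (≈-sym inverse!-0)))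
  binomial-inverse! k (suc j) rewrite ℕ.+-suc k j = begin
    fromℕ (suc n C k) * inverse! (suc n)
      ≈⟨ ≈-trans (*-congʳ (*-recip (fromℕ (suc j)) 0<j+1)) (*-identityˡ _) ⟨
    fromℕ (suc j) * r * (fromℕ (suc n C k) * inverse! (suc n))
      ≈⟨ solve 4 (λ a r b i → a :* r :* (b :* i) := r :* (a :* b :* i)) ≈-refl (fromℕ (suc j)) r
          (fromℕ (suc n C k)) (inverse! (suc n)) ⟩
    r * (fromℕ (suc j) * fromℕ (suc n C k) * inverse! (suc n))
      ≈⟨ *-congˡ (*-congʳ (≈-trans (≈-sym (fromℕ-* (suc j) (suc n C k)))
           (≈-trans (reflexive (≡.cong fromℕ ([j+1]*[k+j+1]Ck≡[k+j+1]*[k+j]Ck k j)))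
               (fromℕ-* (suc n) (n C k))))) ⟩
    r * (fromℕ (suc n) * fromℕ (n C k) * inverse! (suc n))
      ≈⟨ *-congˡ (≈-trans (solve 3 (λ a b i → a :* b :* i := b :* (a :* i)) ≈-refl (fromℕ (suc n))
          (fromℕ (n C k)) (inverse! (suc n)))
           (*-congˡ (inverse!-suc n))) ⟩
    r * (fromℕ (n C k) * inverse! n)
      ≈⟨ *-congˡ (≈-trans (binomial-inverse! k j) (*-congˡ (≈-sym (inverse!-suc j)))) ⟩
    r * (inverse! k * (fromℕ (suc j) * inverse! (suc j)))
      ≈⟨ solve 4 (λ r x a y → r :* (x :* (a :* y)) := a :* r :* (x :* y)) ≈-refl r (inverse! k)
          (fromℕ (suc j)) (inverse! (suc j)) ⟩
    fromℕ (suc j) * r * (inverse! k * inverse! (suc j))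
      ≈⟨ ≈-trans (*-congʳ (*-recip (fromℕ (suc j)) 0<j+1)) (*-identityˡ _) ⟩
    inverse! k * inverse! (suc j) ∎
    where
    n = k ℕ.+ j
    0<j+1 = fromℕ-positive (suc j)
    r = recip (fromℕ (suc j)) 0<j+1

  -- Weights of staircase tableaux

  module Staircase (α β : Carrier) (0<α : 0# < α) (0<β : 0# < β) where

    wt′ : ∀ {n} → Filling n → Carrier
    wt′ = wt α β 0<α 0<β

    Z : ℕ → Carrier
    Z = totalWeight α β 0<α 0<β

    0<Z : ∀ n → 0# < Z n
    0<Z = totalWeight-positive α β 0<α 0<β

    law : ℕ → ℕ → Carrier
    law = lawX α β 0<α 0<β

    Δ : (ℕ → Carrier) → ℕ → Carrier
    Δ φ k = φ (suc k) - φ k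

    rowWt : ∀ {n} → Vec Entry n → Carrier
    rowWt r = α ^ #α r * β ^ #β r

    wt-∷ : ∀ {n} (r : Vec Entry (suc n)) (t : Filling n) →
           wt′ (r ∷ t) ≈ rowWt r * wt′ t
    wt-∷ r t = begin
      α ^ Nα (r ∷ t) * β ^ Nβ (r ∷ t)
        ≡⟨ ≡.cong₂ (λ i j → α ^ i * β ^ j) (Nα-∷ r t) (Nβ-∷ r t) ⟩
      α ^ (#α r ℕ.+ Nα t) * β ^ (#β r ℕ.+ Nβ t)
        ≈⟨ *-cong (^-homo-* α (#α r) (Nα t)) (^-homo-* β (#β r) (Nβ t)) ⟩
      α ^ #α r * α ^ Nα t * (β ^ #β r * β ^ Nβ t)
        ≈⟨ solve 4 (λ a b x y → a :* x :* (b :* y) := a :* b :* (x :* y)) ≈-refl _ _ _ _ ⟩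
      rowWt r * wt′ t ∎

    factor : Carrier → Bool → Carrier
    factor z b = if b then z else 1#

    -- z ^ #true of all bits but the last, provided that the last one is set.
    lastFree : ∀ {n} → Carrier → Vec Bool (suc n) → Carrier
    lastFree z (b ∷ [])      = b ⊙ 1#
    lastFree z (b ∷ b′ ∷ bs) = factor z b * lastFree z (b′ ∷ bs)

    -- Generating sums of a single row

    module _ (z : Carrier) (ψ : ℕ → Carrier) where

      weight : ∀ {n} → Vec Bool n → Vec Entry (suc n) → Carrier
      weight bs r = rowWt r * z ^ #true (freeAfter bs r) * ψ (beforeLast r)

      -- Every α-free column contributes z when left empty and α when filled with α, hence the power
      -- of z + α. The second term corrects for an α in the box next to the diagonal one, which
      -- replaces ψ 0 by ψ 1 and is possible only if its column is α-free.
      rowFactor : ∀ {n} → Vec Bool (suc n) → Carrier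
      rowFactor bs = (z + α) ^ #true bs * ψ 0 + α * lastFree (z + α) bs * Δ ψ 0

      rowFactor-∷ : ∀ {n} b b′ (bs : Vec Bool n) →
                  rowFactor (b ∷ b′ ∷ bs) ≈ factor (z + α) b * rowFactor (b′ ∷ bs)
      rowFactor-∷ true b′ bs = solve 6
        (λ y a p ψ₀ l d → y :* p :* ψ₀ :+ a :* (y :* l) :* d := y :* (p :* ψ₀ :+ a :* l :* d))
        ≈-refl (z + α) α ((z + α) ^ #true (b′ ∷ bs)) (ψ 0) (lastFree (z + α) (b′ ∷ bs)) (Δ ψ 0)
      rowFactor-∷ false b′ bs = solve 5
        (λ a p ψ₀ l d → p :* ψ₀ :+ a :* (:1 :* l) :* d := :1 :* (p :* ψ₀ :+ a :* l :* d))
        ≈-refl α ((z + α) ^ #true (b′ ∷ bs)) (ψ 0) (lastFree (z + α) (b′ ∷ bs)) (Δ ψ 0)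

      weight-empty : ∀ {n} b (bs : Vec Bool (suc n)) r →
                     weight (b ∷ bs) (empty ∷ r) ≈ factor z b * weight bs r
      weight-empty true  bs r@(_ ∷ _ ∷ _) = solve 4
        (λ w z p f → w :* (z :* p) :* f := z :* (w :* p :* f)) ≈-refl (rowWt r) z
            (z ^ #true (freeAfter bs r)) _
      weight-empty false bs r@(_ ∷ _ ∷ _) = ≈-sym (*-identityˡ _)

      weight-α : ∀ {n} b (bs : Vec Bool (suc n)) r →
                 weight (b ∷ bs) (symα ∷ r) ≈ α * weight bs r
      weight-α b bs r@(_ ∷ _ ∷ _) rewrite Bool.∧-zeroʳ b = solve 5
        (λ a x y p f → a :* x :* y :* p :* f := a :* (x :* y :* p :* f)) ≈-refl α (α ^ #α r)
            (β ^ #β r) (z ^ #true (freeAfter bs r)) _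

      weight-β : ∀ {n} (bs : Vec Bool (suc n)) r →
                 weight (true ∷ bs) (symβ ∷ r) ≈ β * z * weight bs r
      weight-β bs r@(_ ∷ _ ∷ _) = solve 6
        (λ b x y z p f → x :* (b :* y) :* (z :* p) :* f := b :* z :* (x :* y :* p :* f)) ≈-refl β
            (α ^ #α r) (β ^ #β r) z (z ^ #true (freeAfter bs r)) _

      -- The diagonal box of a β-free row must hold an α, hence the factor α. The induction starts
      -- at one column instead of none because the box next to the diagonal one is the one seen by
      -- ψ.
      βFreeSum-weight : ∀ {n} (bs : Vec Bool (suc n)) → βFreeSum bs (weight bs) ≈ α * rowFactor bs
      βFreeSum-weight (true ∷ []) = begin
        βFreeSum (true ∷ []) (weight (true ∷ []))
          ≈⟨ βFreeSum-∷ [] true (weight (true ∷ [])) ⟩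
        βFreeSum [] (λ r → weight (true ∷ []) (empty ∷ r)) +
            βFreeSum [] (λ r → weight (true ∷ []) (symα ∷ r))
          ≈⟨ +-cong (βFreeSum-[] (weight (true ∷ []) ∘ (empty ∷_)))
              (βFreeSum-[] (weight (true ∷ []) ∘ (symα ∷_))) ⟩
        weight (true ∷ []) (empty ∷ symα ∷ []) + weight (true ∷ []) (symα ∷ symα ∷ [])
          ≈⟨ solve 4 (λ a z ψ₀ ψ₁ → a :* :1 :* :1 :* (z :* :1) :* ψ₀
                                    :+ a :* (a :* :1) :* :1 :* :1 :* ψ₁
                                    := a :* ((z :+ a) :* :1 :* ψ₀ :+ a :* :1 :* (ψ₁ :- ψ₀)))
               ≈-refl α z (ψ 0) (ψ 1) ⟩
        α * rowFactor (true ∷ []) ∎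
      βFreeSum-weight (false ∷ []) = begin
        βFreeSum (false ∷ []) (weight (false ∷ []))
          ≈⟨ βFreeSum-∷ [] false (weight (false ∷ [])) ⟩
        βFreeSum [] (λ r → weight (false ∷ []) (empty ∷ r)) + 0#
          ≈⟨ +-congʳ (βFreeSum-[] (weight (false ∷ []) ∘ (empty ∷_))) ⟩
        weight (false ∷ []) (empty ∷ symα ∷ []) + 0#
          ≈⟨ solve 3 (λ a ψ₀ ψ₁ → a :* :1 :* :1 :* :1 :* ψ₀ :+ :0
                                    := a :* (:1 :* ψ₀ :+ a :* :0 :* (ψ₁ :- ψ₀)))
               ≈-refl α (ψ 0) (ψ 1) ⟩
        α * rowFactor (false ∷ []) ∎
      βFreeSum-weight (b ∷ bs@(b′ ∷ bs′)) = begin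
        βFreeSum (b ∷ bs) (weight (b ∷ bs))
          ≈⟨ βFreeSum-∷ bs b _ ⟩
        βFreeSum bs (λ r → weight (b ∷ bs) (empty ∷ r)) +
            b ⊙ βFreeSum bs (λ r → weight (b ∷ bs) (symα ∷ r))
          ≈⟨ +-cong (≈-trans (βFreeSum-cong bs (weight-empty b bs)) (βFreeSum-*ˡ bs _ _))
                    (⊙-congˡ b (≈-trans (βFreeSum-cong bs (weight-α b bs)) (βFreeSum-*ˡ bs _ _))) ⟩
        factor z b * βFreeSum bs (weight bs) + b ⊙ (α * βFreeSum bs (weight bs))
          ≈⟨ collect b ⟩
        factor (z + α) b * βFreeSum bs (weight bs)
          ≈⟨ *-congˡ (βFreeSum-weight bs) ⟩
        factor (z + α) b * (α * rowFactor bs)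
          ≈⟨ solve 3 (λ f a w → f :* (a :* w) := a :* (f :* w)) ≈-refl _ _ _ ⟩
        α * (factor (z + α) b * rowFactor bs)
          ≈⟨ *-congˡ (rowFactor-∷ b b′ bs′) ⟨
        α * rowFactor (b ∷ bs) ∎
        where
        collect : ∀ b → factor z b * βFreeSum bs (weight bs) + b ⊙ (α * βFreeSum bs (weight bs)) ≈
            factor (z + α) b * βFreeSum bs (weight bs)
        collect true  = ≈-sym (distribʳ _ _ _)
        collect false = +-identityʳ _

      -- A row contains at most one β, and that β is its leftmost symbol. If the first box is
      -- filled, with α or with β (its column then staying α-free), it contributes α + β z, the same
      -- factor that the rows with an empty first box carry by induction; together they give (α + β
      -- z)(z + α).
      rowSum-weight : ∀ {n} (bs : Vec Bool (suc n)) → rowSum bs (weight bs) ≈ (α + β * z) * rowFactor bs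
      rowSum-weight (true ∷ []) = begin
        rowSum (true ∷ []) (weight (true ∷ []))
          ≈⟨ rowSum-∷ [] true (weight (true ∷ [])) ⟩
        rowSum [] (λ r → weight (true ∷ []) (empty ∷ r)) +
          (βFreeSum [] (λ r → weight (true ∷ []) (symα ∷ r)) +
              βFreeSum [] (λ r → weight (true ∷ []) (symβ ∷ r)))
          ≈⟨ +-cong (rowSum-[] (weight (true ∷ []) ∘ (empty ∷_)))
              (+-cong (βFreeSum-[] (weight (true ∷ []) ∘ (symα ∷_)))
              (βFreeSum-[] (weight (true ∷ []) ∘ (symβ ∷_)))) ⟩
        weight (true ∷ []) (empty ∷ symα ∷ []) + weight (true ∷ []) (empty ∷ symβ ∷ [])
          + (weight (true ∷ []) (symα ∷ symα ∷ []) + weight (true ∷ []) (symβ ∷ symα ∷ []))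
          ≈⟨ solve 5 (λ a b z ψ₀ ψ₁ → a :* :1 :* :1 :* (z :* :1) :* ψ₀
                                    :+ :1 :* (b :* :1) :* (z :* (z :* :1)) :* ψ₀
                                    :+ (a :* (a :* :1) :* :1 :* :1 :* ψ₁
                                     :+ a :* :1 :* (b :* :1) :* (z :* :1) :* ψ₁)
                                    := (a :+ b :* z) :* ((z :+ a) :* :1 :* ψ₀ :+ a :* :1 :* (ψ₁ :- ψ₀)))
               ≈-refl α β z (ψ 0) (ψ 1) ⟩
        (α + β * z) * rowFactor (true ∷ []) ∎
      rowSum-weight (false ∷ []) = begin
        rowSum (false ∷ []) (weight (false ∷ []))
          ≈⟨ rowSum-∷ [] false (weight (false ∷ [])) ⟩
        rowSum [] (λ r → weight (false ∷ []) (empty ∷ r)) + 0#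
          ≈⟨ +-congʳ (rowSum-[] (weight (false ∷ []) ∘ (empty ∷_))) ⟩
        weight (false ∷ []) (empty ∷ symα ∷ []) + weight (false ∷ []) (empty ∷ symβ ∷ []) + 0#
          ≈⟨ solve 5 (λ a b z ψ₀ ψ₁ → a :* :1 :* :1 :* :1 :* ψ₀
                                    :+ :1 :* (b :* :1) :* (z :* :1) :* ψ₀ :+ :0
                                    := (a :+ b :* z) :* (:1 :* ψ₀ :+ a :* :0 :* (ψ₁ :- ψ₀)))
               ≈-refl α β z (ψ 0) (ψ 1) ⟩
        (α + β * z) * rowFactor (false ∷ []) ∎
      rowSum-weight (b ∷ bs@(b′ ∷ bs′)) = begin
        rowSum (b ∷ bs) (weight (b ∷ bs))
          ≈⟨ rowSum-∷ bs b _ ⟩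
        rowSum bs (λ r → weight (b ∷ bs) (empty ∷ r)) +
          b ⊙ (βFreeSum bs (λ r → weight (b ∷ bs) (symα ∷ r)) +
              βFreeSum bs (λ r → weight (b ∷ bs) (symβ ∷ r)))
          ≈⟨ +-congʳ (≈-trans (rowSum-cong bs (weight-empty b bs))
              (≈-trans (rowSum-*ˡ bs _ _) (*-congˡ (rowSum-weight bs)))) ⟩
        factor z b * ((α + β * z) * rowFactor bs) +
          b ⊙ (βFreeSum bs (λ r → weight (b ∷ bs) (symα ∷ r)) +
              βFreeSum bs (λ r → weight (b ∷ bs) (symβ ∷ r)))
          ≈⟨ collect b ⟩
        (α + β * z) * (factor (z + α) b * rowFactor bs)
          ≈⟨ *-congˡ (rowFactor-∷ b b′ bs′) ⟨
        (α + β * z) * rowFactor (b ∷ bs) ∎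
        where
        collect : ∀ b → factor z b * ((α + β * z) * rowFactor bs) +
          b ⊙ (βFreeSum bs (λ r → weight (b ∷ bs) (symα ∷ r)) +
              βFreeSum bs (λ r → weight (b ∷ bs) (symβ ∷ r)))
          ≈ (α + β * z) * (factor (z + α) b * rowFactor bs)
        collect true  = begin
          _ ≈⟨ +-congˡ (+-cong (≈-trans (βFreeSum-cong bs (weight-α true bs))
              (≈-trans (βFreeSum-*ˡ bs _ _) (*-congˡ (βFreeSum-weight bs))))
                               (≈-trans (βFreeSum-cong bs (weight-β bs))
                                   (≈-trans (βFreeSum-*ˡ bs _ _) (*-congˡ (βFreeSum-weight bs))))) ⟩
          z * ((α + β * z) * rowFactor bs) + (α * (α * rowFactor bs) + β * z * (α * rowFactor bs))
            ≈⟨ solve 4 (λ a b z w → z :* ((a :+ b :* z) :* w) :+ (a :* (a :* w) :+ b :* z :* (a :* w))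
                                    := (a :+ b :* z) :* ((z :+ a) :* w)) ≈-refl α β z (rowFactor bs) ⟩
          (α + β * z) * ((z + α) * rowFactor bs) ∎
        collect false = solve 2 (λ x w → :1 :* (x :* w) :+ :0 := x :* (:1 :* w)) ≈-refl _ _

      -- The weight needed for the correction term of the row above: only rows that leave their own
      -- diagonal column α-free count, and that column carries no z.
      weightLast : ∀ {n} → Vec Bool n → Vec Entry (suc n) → Carrier
      weightLast bs r = rowWt r * lastFree z (freeAfter bs r) * ψ (beforeLast r)

      lastFree-∷ : ∀ {n} b (bs : Vec Bool n) r →
                   lastFree z (b ∷ freeAfter bs r) ≈ factor z b * lastFree z (freeAfter bs r)
      lastFree-∷ b []       (_ ∷ []) = ≈-refl
      lastFree-∷ b (_ ∷ bs) (_ ∷ r)  = ≈-refl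

      -- A β-free row ends with an α, so its diagonal column is not α-free and `lastFree` vanishes.
      -- The arbitrary factor `k` absorbs what the columns already split off have contributed.
      βFreeSum-weightLast : ∀ {n} (bs : Vec Bool n) (k : Vec Entry (suc n) → Carrier) →
                        βFreeSum bs (λ r → k r * lastFree z (freeAfter bs r)) ≈ 0#
      βFreeSum-weightLast []       k = ≈-trans
          (βFreeSum-[] (λ r → k r * lastFree z (freeAfter [] r))) (zeroʳ _)
      βFreeSum-weightLast (b ∷ bs) k = begin
        βFreeSum (b ∷ bs) (λ r → k r * lastFree z (freeAfter (b ∷ bs) r))
          ≈⟨ βFreeSum-∷ bs b _ ⟩
        _ ≈⟨ +-cong (βFreeSum-0 empty) (⊙-congˡ b (βFreeSum-0 symα)) ⟩
        0# + b ⊙ 0#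
          ≈⟨ +-identityˡ _ ⟩
        b ⊙ 0#
          ≡⟨ Bool.if-eta b ⟩
        0# ∎
        where
        βFreeSum-0 : ∀ x → βFreeSum bs (λ r → k (x ∷ r) * lastFree z (freeAfter (b ∷ bs) (x ∷ r))) ≈ 0#
        βFreeSum-0 x = ≈-trans
          (βFreeSum-cong bs (λ r → ≈-trans (*-congˡ (lastFree-∷ (b ∧ notα x) bs r))
              (≈-sym (*-assoc _ _ _))))
          (βFreeSum-weightLast bs (λ r → k (x ∷ r) * factor z (b ∧ notα x)))

      -- A β on the diagonal forces the rest of its row to be empty.
      rowSum-weightLast : ∀ {n} (bs : Vec Bool n) → rowSum bs (weightLast bs) ≈ β * z ^ #true bs * ψ 0
      rowSum-weightLast [] = ≈-trans (rowSum-[] (weightLast []))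
        (solve 3 (λ a b ψ₀ → a :* :1 :* :1 :* :0 :* ψ₀
                             :+ :1 :* (b :* :1) :* :1 :* ψ₀
                             := b :* :1 :* ψ₀) ≈-refl α β (ψ 0))
      rowSum-weightLast (b ∷ bs) = begin
        rowSum (b ∷ bs) (weightLast (b ∷ bs))
          ≈⟨ rowSum-∷ bs b _ ⟩
        _ ≈⟨ +-cong (≈-trans (emptyFirst bs) (*-congˡ (rowSum-weightLast bs)))
                    (⊙-congˡ b (+-cong (vanish symα) (vanish symβ))) ⟩
        factor z b * (β * z ^ #true bs * ψ 0) + b ⊙ (0# + 0#)
          ≈⟨ collect b ⟩
        β * z ^ #true (b ∷ bs) * ψ 0 ∎
        where
        vanish : ∀ x → βFreeSum bs (λ r → weightLast (b ∷ bs) (x ∷ r)) ≈ 0#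
        vanish x = ≈-trans
          (βFreeSum-cong bs (λ r → ≈-trans (*-congʳ (*-congˡ (lastFree-∷ (b ∧ notα x) bs r)))
            (solve 4 (λ w f l p → w :* (f :* l) :* p := w :* f :* p :* l) ≈-refl _ _ _ _)))
          (βFreeSum-weightLast bs (λ r →
              rowWt (x ∷ r) * factor z (b ∧ notα x) * ψ (beforeLast (x ∷ r))))
        emptyFirst : ∀ {n} (bs : Vec Bool n) →
          rowSum bs (λ r → weightLast (b ∷ bs) (empty ∷ r)) ≈ factor z b * rowSum bs (weightLast bs)
        emptyFirst bs = ≈-trans (rowSum-cong bs (step bs)) (rowSum-*ˡ bs _ _)
          where
          before-empty : ∀ {n} (r : Vec Entry (suc n)) → beforeLast (empty ∷ r) ≡ beforeLast r
          before-empty (_ ∷ [])    = ≡.refl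
          before-empty (_ ∷ _ ∷ _) = ≡.refl
          step : ∀ {n} (bs : Vec Bool n) r →
              weightLast (b ∷ bs) (empty ∷ r) ≈ factor z b * weightLast bs r
          step bs r rewrite Bool.∧-identityʳ b | before-empty r =
            ≈-trans (*-congʳ (*-congˡ (lastFree-∷ b bs r)))
              (solve 4 (λ w f l p → w :* (f :* l) :* p := f :* (w :* l :* p)) ≈-refl _ _ _ _)
        collect : ∀ b → factor z b * (β * z ^ #true bs * ψ 0) + b ⊙ (0# + 0#) ≈
            β * z ^ #true (b ∷ bs) * ψ 0
        collect true  = solve 4 (λ z b p f → z :* (b :* p :* f) :+ (:0 :+ :0) := b :* (z :* p) :* f)
            ≈-refl _ _ _ _
        collect false = ≈-trans (+-identityʳ _) (*-identityˡ _)

    -- The recursion over rows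

    S : ℕ → Carrier → (ℕ → Carrier) → Carrier
    S n z φ = ∑ (tableaux n) (λ t → wt′ t * z ^ #true (αFree t) * φ (secondDiagonal t))

    S-0 : ∀ z φ → S 0 z φ ≈ φ 0
    S-0 z φ = solve 1 (λ x → :1 :* :1 :* :1 :* x :+ :0 := x) ≈-refl (φ 0)

    private
      split-weight : ∀ {n} (t : Filling n) (p : Vec Entry (suc n) → Carrier) (φ : ℕ → Carrier) r →
        wt′ (r ∷ t) * p r * φ (secondDiagonal (r ∷ t)) ≈
        wt′ t * (rowWt r * p r * φ (beforeLast r ℕ.+ secondDiagonal t))
      split-weight t p φ r rewrite secondDiagonal-∷ r t = ≈-trans (*-congʳ (*-congʳ (wt-∷ r t)))
        (solve 4 (λ a b c d → a :* b :* c :* d := b :* (a :* c :* d)) ≈-refl _ _ _ _)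

      ∑-split : ∀ n (p : ∀ {n} → Vec Bool (suc n) → Carrier) φ →
        ∑ (tableaux (suc n)) (λ t → wt′ t * p (αFree t) * φ (secondDiagonal t)) ≈
        ∑ (tableaux n) (λ t → wt′ t *
          rowSum (αFree t) (λ r → rowWt r * p (freeAfter (αFree t) r)
              * φ (beforeLast r ℕ.+ secondDiagonal t)))
      ∑-split n p φ = ≈-trans (∑-tableaux n _) (∑-cong (λ t → ≈-trans
        (rowSum-cong (αFree t) (split-weight t (λ r → p (freeAfter (αFree t) r)) φ))
        (rowSum-*ˡ (αFree t) _ _)) (tableaux n))

    S-1 : ∀ z φ → S 1 z φ ≈ (α + β * z) * φ 0
    S-1 z φ = ≈-trans (∑-split 0 (λ bs → z ^ #true bs) φ)
        (≈-trans (+-identityʳ _) (≈-trans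
        (*-congˡ (rowSum-[] (λ r → rowWt r * z ^ #true (freeAfter [] r) * φ (beforeLast r ℕ.+ 0))))
      (solve 4 (λ a b z p → :1 :* :1 :*
                            (a :* :1 :* :1 :* :1 :* p
                             :+ :1 :* (b :* :1) :* (z :* :1) :* p)
                            := (a :+ b :* z) :* p) ≈-refl α β z (φ 0))))

    S-suc : ∀ n z φ → S (suc (suc n)) z φ ≈
            (α + β * z) * (S (suc n) (z + α) φ + α * β * S n (z + α) (Δ φ))
    S-suc n z φ = begin
      S (suc (suc n)) z φ
        ≈⟨ ∑-split (suc n) (λ bs → z ^ #true bs) φ ⟩
      ∑ (tableaux (suc n)) (λ t → wt′ t * rowSum (αFree t) (weight z (shift t) (αFree t)))
        ≈⟨ ∑-cong (λ t → ≈-trans (*-congˡ (rowSum-weight z (shift t) (αFree t)))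
             (solve 7 (λ w k p f a l d → w :* (k :* (p :* f :+ a :* l :* d)) :=
                 k :* (w :* p :* f) :+ k :* a :* (w :* l :* d))
                ≈-refl _ _ _ _ _ _ _)) (tableaux (suc n)) ⟩
      ∑ (tableaux (suc n)) (λ t →
          (α + β * z) * (wt′ t * (z + α) ^ #true (αFree t) * φ (secondDiagonal t)) +
                                  (α + β * z) * α * (wt′ t * lastFree (z + α) (αFree t)
                                      * Δ φ (secondDiagonal t)))
        ≈⟨ ≈-trans (∑-+ (tableaux (suc n)) _ _)
            (+-cong (∑-*ˡ _ (tableaux (suc n)) _) (∑-*ˡ _ (tableaux (suc n)) _)) ⟩
      (α + β * z) * S (suc n) (z + α) φ +
      (α + β * z) * α * ∑ (tableaux (suc n))
          (λ t → wt′ t * lastFree (z + α) (αFree t) * Δ φ (secondDiagonal t))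
        -- The second row is split off only in the correction term. Just the row with a lone β
        -- survives there; it adds nothing to the second diagonal and blocks no column below, so a
        -- sum of type `S n` with `Δ φ` is left.
        ≈⟨ +-congˡ (*-congˡ (≈-trans (∑-split n (lastFree (z + α)) (Δ φ)) (≈-trans (∑-cong (λ t →
             ≈-trans (*-congˡ (rowSum-weightLast (z + α) (λ k → Δ φ (k ℕ.+ secondDiagonal t))
                 (αFree t)))
               (solve 4 (λ w b p f → w :* (b :* p :* f) := b :* (w :* p :* f)) ≈-refl _ _ _ _))
                   (tableaux n))
             (∑-*ˡ β (tableaux n) _)))) ⟩
      (α + β * z) * S (suc n) (z + α) φ + (α + β * z) * α * (β * S n (z + α) (Δ φ))
        ≈⟨ solve 5 (λ k s a b r → k :* s :+ k :* a :* (b :* r) := k :* (s :+ a :* b :* r))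
            ≈-refl _ _ _ _ _ ⟩
      (α + β * z) * (S (suc n) (z + α) φ + α * β * S n (z + α) (Δ φ)) ∎
      where
      shift : ∀ {n} → Filling n → ℕ → Carrier
      shift t k = φ (k ℕ.+ secondDiagonal t)

    -- Closed form of the recursion

    F : ℕ → Carrier → Carrier
    F zero    z = 1#
    F (suc n) z = (α + β * z) * F n (z + α)

    γ : Carrier
    γ = α * β

    coeff : ℕ → ℕ → Carrier → Carrier
    coeff n r z = fromℕ ((n ∸ r) C r) * γ ^ r * F (n ∸ r) z

    coeff-0 : ∀ n z → coeff n 0 z ≈ F n z
    coeff-0 n z rewrite nC0≡1 n = solve 1 (λ f → (:1 :+ :0) :* :1 :* f := f) ≈-refl _

    coeff-vanish : ∀ n r z → n ∸ r ℕ.< r → coeff n r z ≈ 0#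
    coeff-vanish n r z l rewrite k>n⇒nCk≡0 l = solve 2 (λ g f → :0 :* g :* f := :0) ≈-refl _ _

    -- Pascal's rule for the binomial and one factor split off from F. For n < r truncated
    -- subtraction no longer satisfies `suc n ∸ r ≡ suc (n ∸ r)`, but all three coefficients are
    -- zero.
    coeff-suc : ∀ n r z → coeff (suc (suc n)) (suc r) z ≈
                (α + β * z) * (coeff (suc n) (suc r) (z + α) + γ * coeff n r (z + α))
    coeff-suc n r z with ℕ.≤-<-connex r n
    ... | inj₁ r≤n rewrite ℕ.+-∸-assoc 1 r≤n = begin
      fromℕ (suc m C suc r) * γ ^ suc r * (p * f)
        ≡⟨ ≡.cong (λ k → fromℕ k * γ ^ suc r * (p * f)) (nCk+nC[k+1]≡[n+1]C[k+1] m r) ⟨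
      fromℕ (m C r ℕ.+ m C suc r) * γ ^ suc r * (p * f)
        ≈⟨ *-congʳ (*-congʳ (fromℕ-+ (m C r) (m C suc r))) ⟩
      (fromℕ (m C r) + fromℕ (m C suc r)) * (γ * γ ^ r) * (p * f)
        ≈⟨ solve 6 (λ x y g h p f → (x :+ y) :* (g :* h) :* (p :* f) :=
            p :* (y :* (g :* h) :* f :+ g :* (x :* h :* f)))
             ≈-refl (fromℕ (m C r)) (fromℕ (m C suc r)) γ (γ ^ r) p f ⟩
      p * (fromℕ (m C suc r) * γ ^ suc r * f + γ * (fromℕ (m C r) * γ ^ r * f)) ∎
      where
      m = n ∸ r
      p = α + β * z
      f = F m (z + α)
    ... | inj₂ n<r = begin
      coeff (suc (suc n)) (suc r) z
        ≈⟨ coeff-vanish (suc (suc n)) (suc r) z (ℕ.≤-<-trans (ℕ.≤-reflexive (ℕ.m≤n⇒m∸n≡0 n<r)) z<s) ⟩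
      0#
        ≈⟨ solve 2 (λ p g → :0 := p :* (:0 :+ g :* :0)) ≈-refl _ _ ⟩
      (α + β * z) * (0# + γ * 0#)
        ≈⟨ *-congˡ (+-cong (coeff-vanish (suc n) (suc r) (z + α)
            (ℕ.≤-<-trans (ℕ.m∸n≤m n r) (ℕ.m<n⇒m<1+n n<r)))
                           (*-congˡ (coeff-vanish n r (z + α) (ℕ.≤-<-trans (ℕ.m∸n≤m n r) n<r)))) ⟨
      (α + β * z) * (coeff (suc n) (suc r) (z + α) + γ * coeff n r (z + α)) ∎

    -- (Δʳ φ) 0
    D : (ℕ → Carrier) → ℕ → Carrier
    D φ zero    = φ 0
    D φ (suc r) = D (Δ φ) r

    -- The summation bound N is free above n because the coefficients vanish there. This aligns the
    -- two sums of the recursion, whose index r is shifted by one, and later lets the range be cut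
    -- at any prescribed place.
    S-closed : ∀ n N z φ → n ℕ.< N → S n z φ ≈ ∑ (upTo N) (λ r → coeff n r z * D φ r)
    S-closed zero (suc N) z φ _ = begin
      S 0 z φ
        ≈⟨ S-0 z φ ⟩
      φ 0
        ≈⟨ ≈-trans (+-cong (*-congʳ (coeff-0 0 z)) (∑-0 (upTo N)))
            (≈-trans (+-identityʳ _) (*-identityˡ _)) ⟨
      coeff 0 0 z * φ 0 + ∑ (upTo N) (λ r → 0#)
        ≈⟨ +-congˡ (∑-cong (λ r → ≈-trans (*-congʳ (coeff-vanish 0 (suc r) z z<s)) (zeroˡ _))
            (upTo N)) ⟨
      coeff 0 0 z * φ 0 + ∑ (upTo N) (λ r → coeff 0 (suc r) z * D φ (suc r))
        ≈⟨ ∑-upTo N _ ⟨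
      ∑ (upTo (suc N)) (λ r → coeff 0 r z * D φ r) ∎
    S-closed (suc zero) (suc N) z φ _ = begin
      S 1 z φ
        ≈⟨ S-1 z φ ⟩
      (α + β * z) * φ 0
        ≈⟨ ≈-trans (+-cong (*-congʳ (coeff-0 1 z)) (∑-0 (upTo N)))
            (≈-trans (+-identityʳ _) (*-congʳ (*-identityʳ _))) ⟨
      coeff 1 0 z * φ 0 + ∑ (upTo N) (λ r → 0#)
        ≈⟨ +-congˡ (∑-cong (λ r → ≈-trans
            (*-congʳ (coeff-vanish 1 (suc r) z (ℕ.≤-<-trans (ℕ.≤-reflexive (ℕ.0∸n≡0 r)) z<s)))
            (zeroˡ _)) (upTo N)) ⟨
      coeff 1 0 z * φ 0 + ∑ (upTo N) (λ r → coeff 1 (suc r) z * D φ (suc r))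
        ≈⟨ ∑-upTo N _ ⟨
      ∑ (upTo (suc N)) (λ r → coeff 1 r z * D φ r) ∎
    S-closed (suc (suc n)) (suc N) z φ (s≤s l) = begin
      S (suc (suc n)) z φ
        ≈⟨ S-suc n z φ ⟩
      p * (S (suc n) (z + α) φ + γ * S n (z + α) (Δ φ))
        ≈⟨ *-congˡ (+-cong (≈-trans (S-closed (suc n) (suc N) (z + α) φ (ℕ.m<n⇒m<1+n l)) (∑-upTo N _))
                           (*-congˡ (S-closed n N (z + α) (Δ φ) (ℕ.<-trans (ℕ.n<1+n n) l)))) ⟩
      p * (coeff (suc n) 0 (z + α) * φ 0 +
          ∑ (upTo N) (λ r → coeff (suc n) (suc r) (z + α) * D φ (suc r))
           + γ * ∑ (upTo N) (λ r → coeff n r (z + α) * D φ (suc r)))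
        ≈⟨ solve 6 (λ p c f s g t → p :* (c :* f :+ s :+ g :* t) :=
            p :* c :* f :+ p :* (s :+ g :* t)) ≈-refl _ _ _ _ _ _ ⟩
      p * coeff (suc n) 0 (z + α) * φ 0 +
          p * (∑ (upTo N) (λ r → coeff (suc n) (suc r) (z + α) * D φ (suc r))
           + γ * ∑ (upTo N) (λ r → coeff n r (z + α) * D φ (suc r)))
        ≈⟨ +-cong (*-congʳ (≈-trans (*-congˡ (coeff-0 (suc n) (z + α)))
            (≈-sym (coeff-0 (suc (suc n)) z))))
            (≈-trans (*-congˡ (≈-trans (+-congˡ (≈-sym (∑-*ˡ γ (upTo N) _)))
                (≈-sym (∑-+ (upTo N) _ _)))) (≈-sym (∑-*ˡ p (upTo N) _))) ⟩
      coeff (suc (suc n)) 0 z * φ 0 + ∑ (upTo N) (λ r → p *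
        (coeff (suc n) (suc r) (z + α) * D φ (suc r) + γ * (coeff n r (z + α) * D φ (suc r))))
        ≈⟨ +-congˡ (∑-cong (λ r → ≈-trans
             (solve 5 (λ p a d g b → p :* (a :* d :+ g :* (b :* d)) := p :* (a :+ g :* b) :* d)
                 ≈-refl _ _ _ _ _)
             (*-congʳ (≈-sym (coeff-suc n r z)))) (upTo N)) ⟩
      coeff (suc (suc n)) 0 z * φ 0 + ∑ (upTo N) (λ r → coeff (suc (suc n)) (suc r) z * D φ (suc r))
        ≈⟨ ∑-upTo N _ ⟨
      ∑ (upTo (suc N)) (λ r → coeff (suc (suc n)) r z * D φ r) ∎
      where p = α + β * z

    -- Differences of constants and of point masses

    D-cong : ∀ {φ ψ} → (∀ k → φ k ≈ ψ k) → ∀ r → D φ r ≈ D ψ r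
    D-cong eq zero    = eq 0
    D-cong eq (suc r) = D-cong (λ k → +-cong (eq (suc k)) (-‿cong (eq k))) r

    D-- : ∀ φ ψ r → D (λ k → φ k - ψ k) r ≈ D φ r - D ψ r
    D-- φ ψ zero    = ≈-refl
    D-- φ ψ (suc r) = ≈-trans
      (D-cong (λ k → solve 4 (λ a b c d → (a :- b) :- (c :- d) := (a :- c) :- (b :- d))
          ≈-refl _ _ _ _) r)
      (D-- (Δ φ) (Δ ψ) r)

    D-0 : ∀ r → D (λ _ → 0#) r ≈ 0#
    D-0 zero    = ≈-refl
    D-0 (suc r) = ≈-trans (D-cong (λ _ → -‿inverseʳ 0#) r) (D-0 r)

    D-const : ∀ x r → D (λ _ → x) (suc r) ≈ 0#
    D-const x r = ≈-trans (D-cong (λ _ → -‿inverseʳ x) r) (D-0 r)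

    δ : ℕ → ℕ → Carrier
    δ k x = (x ℕ.≡ᵇ k) ⊙ 1#

    -- The indicator of suc k, shifted by one, computes to the indicator of k, so its difference is
    -- `δ k` minus `δ (suc k)`.
    D-δ-suc : ∀ k r → D (δ (suc k)) (suc r) ≈ D (δ k) r - D (δ (suc k)) r
    D-δ-suc k r = D-- (δ k) (δ (suc k)) r

    D-δ-< : ∀ k r → r ℕ.< k → D (δ k) r ≈ 0#
    D-δ-< (suc k) zero    _       = ≈-refl
    D-δ-< (suc k) (suc r) (s<s l) = ≈-trans (D-δ-suc k r) (≈-trans
      (+-cong (D-δ-< k r l) (-‿cong (D-δ-< (suc k) r (ℕ.m<n⇒m<1+n l)))) (-‿inverseʳ 0#))

    -- These are the coefficients of binomial inversion; the recursion for differences of point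
    -- masses becomes Pascal's rule up to sign.
    D-δ : ∀ k j → D (δ k) (k ℕ.+ j) ≈ sign j * fromℕ ((k ℕ.+ j) C k)
    D-δ zero    j rewrite nC0≡1 j = ≈-trans (alternate j)
        (≈-sym (≈-trans (*-congˡ fromℕ-1) (*-identityʳ _)))
      where
      alternate : ∀ j → D (δ 0) j ≈ sign j
      alternate zero    = ≈-refl
      alternate (suc j) = ≈-trans (D-- (λ _ → 0#) (δ 0) j)
        (≈-trans (+-cong (D-0 j) (-‿cong (alternate j))) (+-identityˡ _))
    D-δ (suc k) zero = begin
      D (δ (suc k)) (suc (k ℕ.+ 0))
        ≈⟨ D-δ-suc k (k ℕ.+ 0) ⟩
      D (δ k) (k ℕ.+ 0) - D (δ (suc k)) (k ℕ.+ 0)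
        ≈⟨ +-cong (D-δ k 0) (-‿cong (D-δ-< (suc k) (k ℕ.+ 0) (s≤s (ℕ.≤-reflexive (ℕ.+-identityʳ k))))) ⟩
      1# * fromℕ ((k ℕ.+ 0) C k) - 0#
        ≈⟨ ≈-trans (+-congˡ -0#≈0#) (+-identityʳ _) ⟩
      1# * fromℕ ((k ℕ.+ 0) C k)
        ≡⟨ ≡.cong (λ m → 1# * fromℕ m) (≡.trans (diagonal k) (≡.sym (diagonal (suc k)))) ⟩
      1# * fromℕ (suc (k ℕ.+ 0) C suc k) ∎
      where
      diagonal : ∀ k → (k ℕ.+ 0) C k ≡ 1
      diagonal k rewrite ℕ.+-identityʳ k = nCn≡1 k
    D-δ (suc k) (suc j) = begin
      D (δ (suc k)) (suc (k ℕ.+ suc j))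
        ≈⟨ D-δ-suc k (k ℕ.+ suc j) ⟩
      D (δ k) (k ℕ.+ suc j) - D (δ (suc k)) (k ℕ.+ suc j)
        ≈⟨ +-cong (D-δ k (suc j)) (-‿cong (≈-trans (reflexive (≡.cong (D (δ (suc k))) (ℕ.+-suc k j)))
             (≈-trans (D-δ (suc k) j) (reflexive
                 (≡.cong (λ m → sign j * fromℕ (m C suc k)) (≡.sym (ℕ.+-suc k j))))))) ⟩
      - sign j * fromℕ (m C k) - sign j * fromℕ (m C suc k)
        ≈⟨ solve 3 (λ s a b → :- s :* a :- s :* b := :- s :* (a :+ b)) ≈-refl _ _ _ ⟩
      - sign j * (fromℕ (m C k) + fromℕ (m C suc k))
        ≈⟨ *-congˡ (fromℕ-+ (m C k) (m C suc k)) ⟨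
      - sign j * fromℕ (m C k ℕ.+ m C suc k)
        ≡⟨ ≡.cong (λ i → - sign j * fromℕ i) (nCk+nC[k+1]≡[n+1]C[k+1] m k) ⟩
      - sign j * fromℕ (suc m C suc k) ∎
      where m = k ℕ.+ suc j

    S-δ : ∀ n k N → n ℕ.< N → S n 1# (δ k) ≈
          ∑ (upTo N) (λ j → sign j * (fromℕ ((k ℕ.+ j) C k) * coeff n (k ℕ.+ j) 1#))
    S-δ n k N l = begin
      S n 1# (δ k)
        -- The bound k + N leaves exactly N terms once the first k, which vanish, are dropped.
        ≈⟨ S-closed n (k ℕ.+ N) 1# (δ k) (ℕ.<-≤-trans l (ℕ.m≤n+m N k)) ⟩
      ∑ (upTo (k ℕ.+ N)) (λ r → coeff n r 1# * D (δ k) r)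
        ≈⟨ ∑-upTo-drop k N _ (λ r l → ≈-trans (*-congˡ (D-δ-< k r l)) (zeroʳ _)) ⟩
      ∑ (upTo N) (λ j → coeff n (k ℕ.+ j) 1# * D (δ k) (k ℕ.+ j))
        ≈⟨ ∑-cong (λ j → ≈-trans (*-congˡ (D-δ k j))
             (solve 3 (λ a s b → a :* (s :* b) := s :* (b :* a)) ≈-refl _ _ _)) (upTo N) ⟩
      ∑ (upTo N) (λ j → sign j * (fromℕ ((k ℕ.+ j) C k) * coeff n (k ℕ.+ j) 1#)) ∎

    -- The total weight

    W : ℕ → Carrier
    W n = F n 1#

    -- At z = 1 the marking of columns disappears, and a constant φ has no higher differences, so
    -- only the term r = 0 of the closed form remains.
    Z≈W : ∀ n → Z n ≈ W n
    Z≈W n = begin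
      ∑ (tableaux n) (wt′)
        ≈⟨ ∑-cong (λ t → ≈-trans (*-identityʳ _)
            (≈-trans (*-congˡ (1^ (#true (αFree t)))) (*-identityʳ _))) (tableaux n) ⟨
      S n 1# (λ _ → 1#)
        ≈⟨ S-closed n (suc n) 1# _ (ℕ.n<1+n n) ⟩
      ∑ (upTo (suc n)) (λ r → coeff n r 1# * D (λ _ → 1#) r)
        ≈⟨ ∑-upTo n _ ⟩
      coeff n 0 1# * 1# + ∑ (upTo n) (λ r → coeff n (suc r) 1# * D (λ _ → 1#) (suc r))
        ≈⟨ +-cong (≈-trans (*-identityʳ _) (coeff-0 n 1#))
             (≈-trans (∑-cong (λ r → ≈-trans (*-congˡ (D-const 1# r)) (zeroʳ _)) (upTo n))
                 (∑-0 (upTo n))) ⟩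
      W n + 0#
        ≈⟨ +-identityʳ _ ⟩
      W n ∎

    -- By definition F splits off its first factor and moves z. Splitting off the last factor keeps
    -- z fixed, as a recursion at z = 1 requires.
    F-last : ∀ n z → F (suc n) z ≈ (α + β * (z + fromℕ n * α)) * F n z
    F-last zero    z = *-congʳ (+-congˡ (*-congˡ (solve 2 (λ z a → z := z :+ :0 :* a) ≈-refl _ _)))
    F-last (suc n) z = begin
      p * F (suc n) (z + α)
        ≈⟨ *-congˡ (F-last n (z + α)) ⟩
      p * ((α + β * (z + α + fromℕ n * α)) * F n (z + α))
        ≈⟨ solve 6 (λ p a b z n f → p :* ((a :+ b :* (z :+ a :+ n :* a)) :* f)
                      := (a :+ b :* (z :+ (:1 :+ n) :* a)) :* (p :* f)) ≈-refl p α β z (fromℕ n)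
                          (F n (z + α)) ⟩
      (α + β * (z + fromℕ (suc n) * α)) * F (suc n) z ∎
      where p = α + β * z

    W-suc : ∀ n → W (suc n) ≈ (α + β + fromℕ n * γ) * W n
    W-suc n = ≈-trans (F-last n 1#) (*-congʳ
      (solve 3 (λ a b n → a :+ b :* (:1 :+ n :* a) := a :+ b :+ n :* (a :* b)) ≈-refl α β (fromℕ n)))

    -- Convergence of the binomial moments

    0<γ : 0# < γ
    0<γ = *-positive 0<α 0<β

    W⁻¹ : ℕ → Carrier
    W⁻¹ n = recip (Z n) (0<Z n)

    0<W : ∀ n → 0# < W n
    0<W n = <-respʳ-≈ (Z≈W n) (0<Z n)

    W*W⁻¹ : ∀ n → W n * W⁻¹ n ≈ 1#
    W*W⁻¹ n = ≈-trans (*-congʳ (≈-sym (Z≈W n))) (*-recip _ _)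

    -- E C(Xₙ, r)
    moment : ℕ → ℕ → Carrier
    moment n r = coeff n r 1# * W⁻¹ n

    lawX≈ : ∀ n k N → n ℕ.< N →
            law n k ≈ alternating (λ j → fromℕ ((k ℕ.+ j) C k) * moment n (k ℕ.+ j)) N
    lawX≈ n k N n<N = begin
      law n k
        ≈⟨ ∑-filter (λ t → secondDiagonal t ℕ.≟ k) (tableaux n) _ ⟩
      ∑ (tableaux n) (λ t → (secondDiagonal t ℕ.≡ᵇ k) ⊙ ℙ α β 0<α 0<β t)
        ≈⟨ ∑-cong (λ t → ≈-trans (⊙-congˡ (secondDiagonal t ℕ.≡ᵇ k) (divide-recip _ _ _))
            (summand t)) (tableaux n) ⟩
      ∑ (tableaux n) (λ t → W⁻¹ n * (wt′ t * 1# ^ #true (αFree t) * δ k (secondDiagonal t)))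
        ≈⟨ ∑-*ˡ (W⁻¹ n) (tableaux n) _ ⟩
      W⁻¹ n * S n 1# (δ k)
        ≈⟨ *-congˡ (S-δ n k N n<N) ⟩
      W⁻¹ n * ∑ (upTo N) (λ j → sign j * (fromℕ ((k ℕ.+ j) C k) * coeff n (k ℕ.+ j) 1#))
        ≈⟨ ∑-*ˡ (W⁻¹ n) (upTo N) _ ⟨
      ∑ (upTo N) (λ j → W⁻¹ n * (sign j * (fromℕ ((k ℕ.+ j) C k) * coeff n (k ℕ.+ j) 1#)))
        ≈⟨ ∑-cong (λ j → solve 4 (λ w s b a → w :* (s :* (b :* a)) := s :* (b :* (a :* w)))
            ≈-refl _ _ _ _) (upTo N) ⟩
      alternating (λ j → fromℕ ((k ℕ.+ j) C k) * moment n (k ℕ.+ j)) N ∎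
      where
      summand : ∀ t → (secondDiagonal t ℕ.≡ᵇ k) ⊙ (wt′ t * W⁻¹ n) ≈
                      W⁻¹ n * (wt′ t * 1# ^ #true (αFree t) * δ k (secondDiagonal t))
      summand t = begin
        (secondDiagonal t ℕ.≡ᵇ k) ⊙ (wt′ t * W⁻¹ n)
          ≈⟨ ⊙-congˡ (secondDiagonal t ℕ.≡ᵇ k) (≈-trans (*-identityʳ _) (*-comm _ _)) ⟨
        (secondDiagonal t ℕ.≡ᵇ k) ⊙ (W⁻¹ n * wt′ t * 1#)
          ≈⟨ ⊙-*ˡ (secondDiagonal t ℕ.≡ᵇ k) _ 1# ⟨
        W⁻¹ n * wt′ t * δ k (secondDiagonal t)
          ≈⟨ solve 3 (λ w x d → w :* x :* d := w :* (x :* :1 :* d)) ≈-refl _ _ _ ⟩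
        W⁻¹ n * (wt′ t * 1# * δ k (secondDiagonal t))
          ≈⟨ *-congˡ (*-congʳ (*-congˡ (1^ (#true (αFree t))))) ⟨
        W⁻¹ n * (wt′ t * 1# ^ #true (αFree t) * δ k (secondDiagonal t)) ∎

    moment-0 : ∀ n → moment n 0 ≈ 1#
    moment-0 n = ≈-trans (*-congʳ (coeff-0 n 1#)) (W*W⁻¹ n)

    moment-nonnegative : ∀ n r → Nonnegative (moment n r)
    moment-nonnegative n r = nonnegative-*
      (nonnegative-* (nonnegative-* (nonnegative-fromℕ ((n ∸ r) C r)) (inj₂ (^-positive 0<γ r)))
          (inj₂ (0<W (n ∸ r))))
      (inj₂ (recip-positive _ _))

    -- This is not a pointwise inequality, since (r + 1) C(X, r + 1) = (X - r) C(X, r). It is read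
    -- off from the closed form, after writing W (m + 1) as (α + β + m γ) W m.
    moment-decay : ∀ n r → Nonnegative (moment n r - fromℕ (suc r) * moment n (suc r))
    moment-decay n r = [ inside , outside ]′ (ℕ.<-≤-connex r n)
      where
      outside : n ℕ.≤ r → Nonnegative (moment n r - fromℕ (suc r) * moment n (suc r))
      outside n≤r = nonnegative-resp
        (≈-trans (solve 2 (λ x k → x := x :- k :* :0) ≈-refl (moment n r) (fromℕ (suc r)))
          (+-congˡ (-‿cong (*-congˡ (≈-sym (≈-trans (*-congʳ
            (coeff-vanish n (suc r) 1# (ℕ.≤-<-trans (ℕ.m∸n≤m n (suc r)) (s≤s n≤r)))) (zeroˡ _)))))))
        (moment-nonnegative n r)
      m = n ∸ suc r
      -- By the binomial inequality the truncated subtraction is exact, so this difference is a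
      -- natural number and its sign is known without comparing reals.
      d = m ℕ.* (suc m C r) ∸ suc r ℕ.* (m C suc r)
      difference : fromℕ m * fromℕ (suc m C r) ≈ fromℕ (suc r) * fromℕ (m C suc r) + fromℕ d
      difference = begin
        fromℕ m * fromℕ (suc m C r)
          ≈⟨ fromℕ-* m (suc m C r) ⟨
        fromℕ (m ℕ.* (suc m C r))
          ≡⟨ ≡.cong fromℕ (ℕ.m+[n∸m]≡n ([k+1]*nC[k+1]≤n*[n+1]Ck m r)) ⟨
        fromℕ (suc r ℕ.* (m C suc r) ℕ.+ d)
          ≈⟨ ≈-trans (fromℕ-+ (suc r ℕ.* (m C suc r)) d) (+-congʳ (fromℕ-* (suc r) (m C suc r))) ⟩
        fromℕ (suc r) * fromℕ (m C suc r) + fromℕ d ∎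
      factorisation : r ℕ.< n → moment n r - fromℕ (suc r) * moment n (suc r) ≈
        γ ^ r * W m * W⁻¹ n * (fromℕ (suc m C r) * (α + β) + γ * fromℕ d)
      factorisation r<n = begin
        moment n r - fromℕ (suc r) * moment n (suc r)
          -- For r < n the number n ∸ r is `suc m`, which exposes the factor of W to be split off.
          ≡⟨ ≡.cong (λ i → fromℕ (i C r) * γ ^ r * W i * W⁻¹ n - fromℕ (suc r) * moment n (suc r))
              (ℕ.+-∸-assoc 1 r<n) ⟩
        fromℕ (suc m C r) * γ ^ r * W (suc m) * W⁻¹ n -
            fromℕ (suc r) * (fromℕ (m C suc r) * (γ * γ ^ r) * W m * W⁻¹ n)
          ≈⟨ +-congʳ (*-congʳ (*-congˡ (W-suc m))) ⟩
        fromℕ (suc m C r) * γ ^ r * ((α + β + fromℕ m * γ) * W m) * W⁻¹ n -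
            fromℕ (suc r) * (fromℕ (m C suc r) * (γ * γ ^ r) * W m * W⁻¹ n)
          ≈⟨ solve 9 (λ b g s m c w i r b′ →
              b :* g :* ((s :+ m :* c) :* w) :* i :- r :* (b′ :* (c :* g) :* w :* i)
                        := g :* w :* i :* (b :* s :+ c :* (m :* b :- r :* b′)))
               ≈-refl (fromℕ (suc m C r)) (γ ^ r) (α + β) (fromℕ m) γ (W m) (W⁻¹ n) (fromℕ (suc r))
                   (fromℕ (m C suc r)) ⟩
        γ ^ r * W m * W⁻¹ n * (fromℕ (suc m C r) * (α + β) +
            γ * (fromℕ m * fromℕ (suc m C r) - fromℕ (suc r) * fromℕ (m C suc r)))
          ≈⟨ *-congˡ (+-congˡ (*-congˡ (≈-trans (+-congʳ difference)
               (solve 2 (λ x d → x :+ d :- x := d) ≈-refl _ _)))) ⟩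
        γ ^ r * W m * W⁻¹ n * (fromℕ (suc m C r) * (α + β) + γ * fromℕ d) ∎
      inside : r ℕ.< n → Nonnegative (moment n r - fromℕ (suc r) * moment n (suc r))
      inside r<n = nonnegative-resp (≈-sym (factorisation r<n)) (nonnegative-*
        (nonnegative-* (nonnegative-* (inj₂ (^-positive 0<γ r)) (inj₂ (0<W m)))
            (inj₂ (recip-positive _ _)))
        (nonnegative-+ (nonnegative-* (nonnegative-fromℕ (suc m C r)) (inj₂ (+-positive 0<α 0<β)))
                       (nonnegative-* (inj₂ 0<γ) (nonnegative-fromℕ d))))

    moment-≤1 : ∀ n r → Nonnegative (1# - moment n r)
    moment-≤1 n = FastDecay.≤1 record
      { nonnegative = moment-nonnegative n
      ; decay       = moment-decay n
      ; initial     = inj₁ (≈-trans (+-congˡ (-‿cong (moment-0 n))) (-‿inverseʳ 1#))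
      }

    -- Since (j + 1) C(k + j + 1, k) = (k + j + 1) C(k + j, k), the decay condition is C(k + j, k)
    -- times the one for moments at k + j. The first term is the k-th moment, which is at most 1.
    shiftedMoment-fastDecay : ∀ n k → FastDecay (λ j → fromℕ ((k ℕ.+ j) C k) * moment n (k ℕ.+ j))
    shiftedMoment-fastDecay n k = record
      { nonnegative = λ j → nonnegative-* (nonnegative-fromℕ ((k ℕ.+ j) C k))
          (moment-nonnegative n (k ℕ.+ j))
      ; decay       = λ j → nonnegative-resp (factorisation j)
                        (nonnegative-* (nonnegative-fromℕ ((k ℕ.+ j) C k)) (moment-decay n (k ℕ.+ j)))
      ; initial     = nonnegative-resp (+-congˡ (-‿cong (first k))) (moment-≤1 n k)
      }
      where
      first : ∀ k → moment n k ≈ fromℕ ((k ℕ.+ 0) C k) * moment n (k ℕ.+ 0)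
      first k = ≡.subst (λ i → moment n k ≈ fromℕ (i C k) * moment n i) (≡.sym (ℕ.+-identityʳ k))
        (≈-sym (≈-trans (*-congʳ (≈-trans (reflexive (≡.cong fromℕ (nCn≡1 k))) fromℕ-1))
            (*-identityˡ _)))
      factorisation : ∀ j →
        fromℕ ((k ℕ.+ j) C k) * (moment n (k ℕ.+ j) -
            fromℕ (suc (k ℕ.+ j)) * moment n (suc (k ℕ.+ j))) ≈
        fromℕ ((k ℕ.+ j) C k) * moment n (k ℕ.+ j) -
            fromℕ (suc j) * (fromℕ ((k ℕ.+ suc j) C k) * moment n (k ℕ.+ suc j))
      factorisation j = ≡.subst
        (λ i′ → b * (x - fromℕ (suc i) * y) ≈ b * x - fromℕ (suc j) * (fromℕ (i′ C k) * moment n i′))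
        (≡.sym (ℕ.+-suc k j)) (begin
        b * (x - fromℕ (suc i) * y)
          ≈⟨ solve 4 (λ b x i y → b :* (x :- i :* y) := b :* x :- i :* b :* y) ≈-refl _ _ _ _ ⟩
        b * x - fromℕ (suc i) * b * y
          ≈⟨ +-congˡ (-‿cong (*-congʳ (≈-trans (≈-sym (fromℕ-* (suc i) (i C k)))
               (≈-trans (reflexive (≡.cong fromℕ (≡.sym ([j+1]*[k+j+1]Ck≡[k+j+1]*[k+j]Ck k j))))
                   (fromℕ-* (suc j) (suc i C k)))))) ⟩
        b * x - fromℕ (suc j) * fromℕ (suc i C k) * y
          ≈⟨ +-congˡ (-‿cong (*-assoc _ _ _)) ⟩
        b * x - fromℕ (suc j) * (fromℕ (suc i C k) * y) ∎)
        where
        i = k ℕ.+ j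
        b = fromℕ (i C k)
        x = moment n i
        y = moment n (suc i)

    0<ratio : ∀ n → 0# < α + β + fromℕ n * γ
    0<ratio n = positive-+ (+-positive 0<α 0<β) (nonnegative-* (nonnegative-fromℕ n) (inj₂ 0<γ))

    ratio⁻¹ : ℕ → Carrier
    ratio⁻¹ n = recip (α + β + fromℕ n * γ) (0<ratio n)

    W⁻¹-suc : ∀ n → ratio⁻¹ n * W⁻¹ n ≈ W⁻¹ (suc n)
    W⁻¹-suc n = recip-unique _ (begin
      Z (suc n) * (ratio⁻¹ n * W⁻¹ n)
        ≈⟨ *-congʳ (≈-trans (Z≈W (suc n)) (W-suc n)) ⟩
      (α + β + fromℕ n * γ) * W n * (ratio⁻¹ n * W⁻¹ n)
        ≈⟨ solve 4 (λ a w t i → a :* w :* (t :* i) := a :* t :* (w :* i)) ≈-refl _ _ _ _ ⟩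
      (α + β + fromℕ n * γ) * ratio⁻¹ n * (W n * W⁻¹ n)
        ≈⟨ *-cong (*-recip _ _) (W*W⁻¹ n) ⟩
      1# * 1#
        ≈⟨ *-identityˡ 1# ⟩
      1# ∎)

    ratio⁻¹⟶0 : ratio⁻¹ ⟶ 0#
    ratio⁻¹⟶0 ε 0<ε = let N , h = fromℕ-exceeds (*-positive 0<γ 0<ε) in N , λ n N≤n →
        within (∣∣<-resp (solve 1 (λ x → x := x :- :0) ≈-refl _)
      (nonnegative-∣∣< (inj₂ (recip-positive _ (0<ratio n)))
        -- With t the reciprocal of α + β + n γ, ε - t = t ((α + β) ε + (n γ ε - 1)).
        (<-by (*-positive (recip-positive _ (0<ratio n))
            (+-positive (*-positive (+-positive 0<α 0<β) 0<ε) (<⇒0<- (h n N≤n))))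
          (≈-trans (solve 5 (λ t s e m g → t :* (s :* e :+ (m :* (g :* e) :- :1)) :=
              (s :+ m :* g) :* t :* e :- t)
                     ≈-refl (ratio⁻¹ n) (α + β) ε (fromℕ n) γ)
            (+-congʳ (≈-trans (*-congʳ (*-recip _ (0<ratio n))) (*-identityˡ ε)))))))

    -- Raising n and r together keeps n - r, and with it W (n - r). What changes is (r + 1) C(n - r,
    -- r + 1) = (n - 2 r) C(n - r, r) and the quotient W n / W (n + 1), and (n - 2 r) γ / (α + β + n
    -- γ) is 1 minus a multiple of the reciprocal.
    moment-suc : ∀ n r → r ℕ.≤ n →
      (1# - (α + β + (fromℕ r + fromℕ r) * γ) * ratio⁻¹ n) * moment n r ≈
          fromℕ (suc r) * moment (suc n) (suc r)
    moment-suc n r r≤n = begin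
      (1# - (α + β + (fromℕ r + fromℕ r) * γ) * t) * (b * g * w * i)
        ≈⟨ *-congʳ (+-congʳ one) ⟨
      ((α + β + (fromℕ m + fromℕ r) * γ) * t - (α + β + (fromℕ r + fromℕ r) * γ) * t) * (b * g * w * i)
        ≈⟨ solve 9 (λ s m r y t c g w i →
            ((s :+ (m :+ r) :* y) :* t :- (s :+ (r :+ r) :* y) :* t) :* (c :* g :* w :* i)
                      := (m :* c :- r :* c) :* (y :* g) :* w :* (t :* i))
             ≈-refl (α + β) (fromℕ m) (fromℕ r) γ t b g w i ⟩
      (fromℕ m * b - fromℕ r * b) * (γ * g) * w * (t * i)
        ≈⟨ *-cong (*-congʳ (*-congʳ absorb)) (W⁻¹-suc n) ⟩
      fromℕ (suc r) * fromℕ (m C suc r) * (γ * g) * w * W⁻¹ (suc n)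
        ≈⟨ solve 5 (λ r b g w i → r :* b :* g :* w :* i := r :* (b :* g :* w :* i)) ≈-refl _ _ _ _ _ ⟩
      fromℕ (suc r) * moment (suc n) (suc r) ∎
      where
      m = n ∸ r
      t = ratio⁻¹ n
      b = fromℕ (m C r)
      g = γ ^ r
      w = W m
      i = W⁻¹ n
      one : (α + β + (fromℕ m + fromℕ r) * γ) * t ≈ 1#
      one = ≈-trans (*-congʳ (+-congˡ (*-congʳ (≈-trans (≈-sym (fromℕ-+ m r))
        (reflexive (≡.cong fromℕ (ℕ.m∸n+n≡m r≤n))))))) (*-recip _ (0<ratio n))
      absorb : fromℕ m * b - fromℕ r * b ≈ fromℕ (suc r) * fromℕ (m C suc r)
      absorb = begin
        fromℕ m * b - fromℕ r * b
          ≈⟨ +-congʳ (≈-trans (≈-sym (fromℕ-* m (m C r))) (≈-trans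
               (reflexive (≡.cong fromℕ (≡.sym ([k+1]*nC[k+1]+k*nCk≡n*nCk m r))))
               (≈-trans (fromℕ-+ (suc r ℕ.* (m C suc r)) (r ℕ.* (m C r)))
                 (+-cong (fromℕ-* (suc r) (m C suc r)) (fromℕ-* r (m C r)))))) ⟩
        fromℕ (suc r) * fromℕ (m C suc r) + fromℕ r * b - fromℕ r * b
          ≈⟨ solve 2 (λ x y → x :+ y :- y := x) ≈-refl _ _ ⟩
        fromℕ (suc r) * fromℕ (m C suc r) ∎

    moment⟶ : ∀ r → (λ n → moment n r) ⟶ inverse! r
    moment⟶ zero    = ⟶-resp (λ n → ≈-sym (moment-0 n)) (≈-sym inverse!-0) (⟶-const 1#)
    -- The moment of order r at size n determines the one of order r + 1 at size n + 1 once n ≥ r;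
    -- the limit is divided by r + 1, as for the inverse factorials.
    moment⟶ (suc r) = ⟶-unshift (⟶-eventually r (λ n r≤n → cancel (moment-suc n r r≤n))
      (⟶-resp (λ _ → ≈-refl) (cancel limit)
        (⟶-* (⟶-const (recip (fromℕ (suc r)) 0<r+1))
             (⟶-* (⟶-+ (⟶-const 1#) (⟶-* (⟶-const (- k)) ratio⁻¹⟶0)) (moment⟶ r)))))
      where
      0<r+1 = fromℕ-positive (suc r)
      k = α + β + (fromℕ r + fromℕ r) * γ
      cancel : ∀ {t x y} → (1# - k * t) * x ≈ fromℕ (suc r) * y →
               recip (fromℕ (suc r)) 0<r+1 * ((1# + - k * t) * x) ≈ y
      cancel {t} {x} {y} eq = begin
        recip (fromℕ (suc r)) 0<r+1 * ((1# + - k * t) * x)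
          ≈⟨ *-congˡ (≈-trans (solve 3 (λ k t x → (:1 :+ :- k :* t) :* x := (:1 :- k :* t) :* x)
              ≈-refl k t x) eq) ⟩
        recip (fromℕ (suc r)) 0<r+1 * (fromℕ (suc r) * y)
          ≈⟨ ≈-trans (solve 3 (λ a b y → a :* (b :* y) := b :* a :* y) ≈-refl _ _ _)
               (≈-trans (*-congʳ (*-recip _ 0<r+1)) (*-identityˡ y)) ⟩
        y ∎
      limit : (1# - k * 0#) * inverse! r ≈ fromℕ (suc r) * inverse! (suc r)
      limit = ≈-trans (solve 2 (λ k x → (:1 :- k :* :0) :* x := x) ≈-refl k (inverse! r))
          (≈-sym (inverse!-suc r))

    lawX⟶ : ∀ {e} → alternating inverse! ⟶ e → ∀ k → (λ n → law n k) ⟶ inverse! k * e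
    lawX⟶ exp k = ⟶-uniform
      (λ ε 0<ε → let M , h = fastDecay-tail 0<ε in
        -- The range m + (n + 1) exceeds n, so the alternating sum over it equals the probability
        -- exactly, and its first m terms form the truncation.
        M , λ m M≤m n → within-resp (≈-sym (lawX≈ n k (m ℕ.+ suc n) (ℕ.m≤n+m (suc n) m))) ≈-refl
                          (h m M≤m (shiftedMoment-fastDecay n k) (suc n)))
      (λ m → ⟶-∑ (upTo m) (λ j → ⟶-* (⟶-const (sign j))
        (⟶-resp (λ _ → ≈-refl) (binomial-inverse! k j)
          (⟶-* (⟶-const (fromℕ ((k ℕ.+ j) C k))) (moment⟶ (k ℕ.+ j))))))
      (⟶-resp (λ m → ≈-trans (≈-sym (∑-*ˡ (inverse! k) (upTo m) _))
          (∑-cong (λ j → solve 3 (λ a s b → a :* (s :* b) := s :* (a :* b)) ≈-refl _ _ _) (upTo m)))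
              ≈-refl
        (⟶-* (⟶-const (inverse! k)) exp))

-- Convergence in distribution

theorem3p9 : ∀ {c ℓ₁ ℓ₂ ℓ₃} (R : RealNumbers c ℓ₁ ℓ₂ ℓ₃) →
    let open RealNumbers R
        open Probability R in
    (α β : Carrier) (0<α : 0# < α) (0<β : 0# < β) →
    ∃[ q ] IsPoisson 1# q × ConvergesInDistribution (lawX α β 0<α 0<β) q
theorem3p9 R α β 0<α 0<β =
  let e , isExp , lim = exp-1 in
  (λ k → e * expTerm 1# k) , (e , isExp , λ k → ≈-refl) ,
  -- The list of indices depends on x but not on n, so the distribution functions are sums over a
  -- fixed finite list and converge with the mass functions.
  λ x _ → ⟶-∑ (filter (Point.decide≤ x) (upTo (proj₁ (archimedean (Point.value x)))))
      (λ k → ⟶-resp (λ _ → ≈-refl) (≈-trans (*-comm _ _) (*-congˡ (≈-sym (expTerm-1 k)))) (lawX⟶ lim k))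
  where
  open RealNumbers R
  open Probability R
  open RealAnalysis R
  open Staircase α β 0<α 0<β
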